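{- For every integer $r\ge5$, there are exactly nine $r$-Wilf-equivalence classes among the twelve vincular patterns of length three: the classes $\{2\overline{13},2\overline{31}\}$, $\{1\overline{23},1\overline{32}\}$, $\{3\overline{21},3\overline{12}\}$, and six further classes each consisting of a single one of the remaining patterns $\overline{13}2,\ \overline{31}2,\ \overline{12}3,\ \overline{21}3,\ \overline{23}1,\ \overline{32}1$.
   Context: $S_n$ is the set of permutations of $\{1,\ldots,n\}$ written as sequences $(\tau(1),\ldots,\tau(n))$. Three entries $xyz$ form an $abc$ pattern ($abc\in S_3$) if they are in the same relative order as $abc$. Vincular patterns of length three (exactly two entries, under the overline, required to be adjacent): $\tau\in S_n$ contains $a\overline{bc}$ if there exist indices $i<j$ such that $\tau(i)\tau(j)\tau(j+1)$ is an $abc$ pattern; $\tau$ contains $\overline{ab}c$ if there exist indices $i$, $j$ with $i+1<j$ such that $\tau(i)\tau(i+1)\tau(j)$ is an $abc$ pattern; otherwise $\tau$ avoids the vincular pattern. There are twelve such patterns. For $1\le r\le n$, $S_{n,r}(\sigma)$ is the set of $\tau\in S_n$ with $\tau(1)=r$ that avoid $\sigma$. For fixed $r\in\{1,2,\ldots\}$, patterns $\sigma,\sigma'$ are $r$-Wilf equivalent if $|S_{n,r}(\sigma)|=|S_{n,r}(\sigma')|$ for all $n\ge r$. -}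

module Defs where

open import Data.Nat using (ℕ; suc; _≤_; _<_)
open import Data.Fin as Fin using (Fin; toℕ)
open import Data.Vec as Vec using (Vec; []; _∷_; lookup)
open import Data.List as List using (List; length)
open import Data.List.Membership.Propositional using (_∈_)
open import Data.List.Relation.Unary.All using (All)
open import Data.List.Relation.Unary.Any using (Any)
open import Data.List.Relation.Unary.AllPairs using (AllPairs)
open import Data.List.Relation.Unary.Unique.Propositional using (Unique)
open import Data.List.Relation.Binary.Disjoint.Propositional using (Disjoint)
open import Data.Product using (∃-syntax; _×_)
open import Function.Bundles using (_⇔_)
open import Function.Definitions using (Bijective)
open import Relation.Binary.PropositionalEquality using (_≡_)
open import Relation.Nullary using (¬_)

-- A permutation of {1,…,n} is a sequence τ : Vec (Fin n) n; the element
-- i : Fin n stands for the number suc (toℕ i), both as a position and as a value.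
IsPermutation : ∀ {n} → Vec (Fin n) n → Set
IsPermutation τ = Bijective _≡_ _≡_ (lookup τ)

infix 9 _⟨_⟩
_⟨_⟩ : ∀ {n} → Vec (Fin n) n → Fin n → ℕ
τ ⟨ i ⟩ = suc (toℕ (lookup τ i))

data S₃ : Set where
  p123 p132 p213 p231 p312 p321 : S₃

letters : S₃ → Vec ℕ 3
letters p123 = 1 ∷ 2 ∷ 3 ∷ []
letters p132 = 1 ∷ 3 ∷ 2 ∷ []
letters p213 = 2 ∷ 1 ∷ 3 ∷ []
letters p231 = 2 ∷ 3 ∷ 1 ∷ []
letters p312 = 3 ∷ 1 ∷ 2 ∷ []
letters p321 = 3 ∷ 2 ∷ 1 ∷ []

SameRelativeOrder : ∀ {m} → Vec ℕ m → Vec ℕ m → Set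
SameRelativeOrder u v = ∀ s t → (lookup u s < lookup u t) ⇔ (lookup v s < lookup v t)

-- The letters not separated by the dash are the overlined (adjacent) ones.
data VincularPattern : Set where
  a-bc : S₃ → VincularPattern
  ab-c : S₃ → VincularPattern

Contains : ∀ {n} → Vec (Fin n) n → VincularPattern → Set
Contains τ (a-bc p) =
  ∃[ i ] ∃[ j ] ∃[ k ] i Fin.< j × toℕ k ≡ suc (toℕ j)
    × SameRelativeOrder (τ ⟨ i ⟩ ∷ τ ⟨ j ⟩ ∷ τ ⟨ k ⟩ ∷ []) (letters p)
Contains τ (ab-c p) =
  ∃[ i ] ∃[ j ] ∃[ k ] toℕ j ≡ suc (toℕ i) × j Fin.< k
    × SameRelativeOrder (τ ⟨ i ⟩ ∷ τ ⟨ j ⟩ ∷ τ ⟨ k ⟩ ∷ []) (letters p)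

Avoids : ∀ {n} → Vec (Fin n) n → VincularPattern → Set
Avoids τ σ = ¬ Contains τ σ

-- S n r σ τ says that τ belongs to the set S_{n,r}(σ).
S : (n r : ℕ) → VincularPattern → Vec (Fin n) n → Set
S n r σ τ = IsPermutation τ × (∃[ i ] toℕ i ≡ 0 × τ ⟨ i ⟩ ≡ r) × Avoids τ σ

HasCardinality : {A : Set} → (A → Set) → ℕ → Set
HasCardinality P k =
  ∃[ xs ] Unique xs × (∀ x → x ∈ xs ⇔ P x) × length xs ≡ k

RWilfEquivalent : ℕ → VincularPattern → VincularPattern → Set
RWilfEquivalent r σ σ′ =
  ∀ n → r ≤ n → ∃[ k ] HasCardinality (S n r σ) k × HasCardinality (S n r σ′) k

IsClassOf : {A : Set} → (A → A → Set) → List A → Set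
IsClassOf _~_ c = ∃[ x ] (∀ y → y ∈ c ⇔ x ~ y)

-- cs lists all the classes of _~_, each exactly once.
record AreTheClassesOf {A : Set} (_~_ : A → A → Set) (cs : List (List A)) : Set where
  field
    classes  : All (IsClassOf _~_) cs
    covering : ∀ x → Any (x ∈_) cs
    distinct : AllPairs Disjoint cs

{-# OPTIONS --safe #-}
module Submission where

-- Deleting the first entry and standardising turns counting by first entry into recurrences.
-- For ab-c the recurrences only compare the first two entries and give triangles of Bell numbers
-- (12-3, 23-1) or ballot numbers (13-2). For 1-23 and 1-32 a common recurrence follows the monotone
-- runs between left-to-right minima; the 2-13-avoiders starting with r are counted by a product of
-- two Catalan numbers symmetric under complementation, which exchanges 2-13 and 2-31. Reversal and
-- complementation transfer this to the other patterns and identify the totals as Bell numbers B and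
-- Catalan numbers C. The sizes for n = r and n = r + 1 separate all classes, except that {1-23, 1-32}
-- and 12-3 first differ at n = r + 2. For 13-2 and 32-1 neither size alone suffices, because Bell numbers
-- overtake Catalan numbers; there C_r < 4 C_{r-1} and B_{r-1} ≥ 3 B_{r-2} together exclude equality.

-- `bell` and `catalan` are merely the totals that two of the recurrences produce; no closed formula
-- enters. Where different recurrences yield the same totals, they are matched by `card-unique`
-- across a bijection of avoiders, not by algebra. Complementation sends a first entry to its mirror
-- image, so it acts on the refined counts; reversal loses sight of the first entry and can only
-- compare totals. Totals are nevertheless enough, because for the two smallest n nearly all of the
-- sizes reduce to totals for shorter lengths, to 1, or to elementary numbers such as a power of
-- two. The bound 5 on the first entry enters through numbers one or two indices lower: the fourth
-- Catalan number 14 is below the fourth Bell number 15, while the third ones are both 5, and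
-- tripling of Bell numbers sets in with 3 * 5 = 15.

open import Defs
open import Data.Empty using (⊥-elim)
open import Data.Fin as Fin using (Fin; zero; suc; toℕ; fromℕ; fromℕ<; punchIn; punchOut; opposite)
open import Data.Fin.Patterns
import Data.Fin.Properties as Fin
open import Data.List as List using (List; []; _∷_; [_]; length)
open import Data.List.Membership.Propositional using (_∈_)
import Data.List.Membership.Propositional.Properties as Mem
open import Data.List.Membership.Propositional.Properties.WithK using (unique∧set⇒bag)
import Data.List.Properties as List
open import Data.List.Relation.Binary.BagAndSetEquality using (∼bag⇒↭)
open import Data.List.Relation.Binary.Permutation.Propositional.Properties using (↭-length)
open import Data.List.Relation.Unary.All as All using (All; []; _∷_)
import Data.List.Relation.Unary.All.Properties as All
open import Data.List.Relation.Unary.AllPairs using ([]; _∷_)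
import Data.List.Relation.Unary.AllPairs.Properties as AllPairs
open import Data.List.Relation.Unary.Any using (here; there)
import Data.List.Relation.Unary.Any.Properties as Any
import Data.List.Relation.Unary.Unique.Propositional.Properties as Unique
open import Data.Nat
open import Data.Nat.Properties
open import Data.Nat.Tactic.RingSolver using (solve-∀)
open import Data.Product using (∃-syntax; _×_; _,_; proj₁; proj₂)
open import Data.Sum using (_⊎_; inj₁; inj₂; [_,_]′)
open import Data.Unit using (⊤; tt)
open import Data.Vec as Vec using (Vec; []; _∷_; lookup; head; map; tabulate)
import Data.Vec.Properties as Vec
open import Function using (_∘_; id; _⇔_; mk⇔; Equivalence)
open import Relation.Binary using (tri<; tri≈; tri>)
open import Relation.Binary.PropositionalEquality hiding ([_])
open import Relation.Nullary using (¬_; yes; no; contradiction)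
open import Relation.Nullary.Decidable using (toWitness; _→-dec_)

open Equivalence

private variable
  n : ℕ

-- Counting permutations by their first entry

card-unique : ∀ {A : Set} {P : A → Set} {k l} → HasCardinality P k → HasCardinality P l → k ≡ l
card-unique (xs , xs! , xs∈ , refl) (ys , ys! , ys∈ , refl) =
  ↭-length (∼bag⇒↭ (unique∧set⇒bag xs! ys! λ {x} →
    mk⇔ (from (ys∈ x) ∘ to (xs∈ x)) (from (xs∈ x) ∘ to (ys∈ x))))

card-cong : ∀ {A : Set} {P Q : A → Set} {k} → (∀ x → P x ⇔ Q x) →
            HasCardinality P k → HasCardinality Q k
card-cong P⇔Q (xs , xs! , xs∈ , len) =
  xs , xs! , (λ x → mk⇔ (to (P⇔Q x) ∘ to (xs∈ x)) (from (xs∈ x) ∘ from (P⇔Q x))) , len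

card-∅ : ∀ {A : Set} {P : A → Set} → (∀ x → ¬ P x) → HasCardinality P 0
card-∅ ¬P = [] , [] , (λ x → mk⇔ (λ ()) (⊥-elim ∘ ¬P x)) , refl

card-image : ∀ {A B : Set} {P : A → Set} {Q : B → Set} {k} (f : A → B) →
             (∀ {x y} → f x ≡ f y → x ≡ y) → (∀ y → Q y ⇔ (∃[ x ] P x × y ≡ f x)) →
             HasCardinality P k → HasCardinality Q k
card-image f f-inj Q⇔ (xs , xs! , xs∈ , len) =
  List.map f xs , Unique.map⁺ f-inj xs! ,
  (λ y → mk⇔
    (λ y∈ → let x , x∈ , eq = Mem.∈-map⁻ f y∈ in from (Q⇔ y) (x , to (xs∈ x) x∈ , eq))
    (λ q → let x , p , eq = to (Q⇔ y) q in subst (_∈ _) (sym eq) (Mem.∈-map⁺ f (from (xs∈ x) p)))) ,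
  trans (List.length-map f xs) len

card-⊎ : ∀ {A : Set} {P Q : A → Set} {k l} → (∀ x → P x → ¬ Q x) →
         HasCardinality P k → HasCardinality Q l → HasCardinality (λ x → P x ⊎ Q x) (k + l)
card-⊎ disj (xs , xs! , xs∈ , refl) (ys , ys! , ys∈ , refl) =
  xs List.++ ys ,
  Unique.++⁺ xs! ys! (λ (x∈ , y∈) → disj _ (to (xs∈ _) x∈) (to (ys∈ _) y∈)) ,
  (λ x → mk⇔
    (λ x∈ → [ inj₁ ∘ to (xs∈ x) , inj₂ ∘ to (ys∈ x) ]′ (Mem.∈-++⁻ xs x∈))
    [ Mem.∈-++⁺ˡ ∘ from (xs∈ x) , Mem.∈-++⁺ʳ xs ∘ from (ys∈ x) ]′) ,
  List.length-++ xs

card-involution : ∀ {A : Set} {P Q : A → Set} {k} (f : A → A) → (∀ x → f (f x) ≡ x) →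
                  (∀ x → P x → Q (f x)) → (∀ x → Q x → P (f x)) →
                  HasCardinality P k → HasCardinality Q k
card-involution f invol P⇒Q Q⇒P = card-image f
  (λ {x} {y} eq → trans (sym (invol x)) (trans (cong f eq) (invol y)))
  (λ y → mk⇔ (λ q → f y , Q⇒P y q , sym (invol y)) λ where (x , p , refl) → P⇒Q x p)

-- Pigeonhole: if some y were missed, punching y out of all entries would inject `Fin (suc n)` into
-- `Fin n`. Hence every construction below only has to preserve injectivity.
injective⇒permutation : (τ : Vec (Fin n) n) → (∀ {i j} → lookup τ i ≡ lookup τ j → i ≡ j) →
                        IsPermutation τ
injective⇒permutation {zero}  τ inj = inj , λ ()
injective⇒permutation {suc n} τ inj = inj , onto
  where
  onto : ∀ y → ∃[ x ] (∀ {z} → z ≡ x → lookup τ z ≡ y)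
  onto y with Fin.any? (λ x → lookup τ x Fin.≟ y)
  ... | yes (x , eq) = x , λ where refl → eq
  ... | no ∄ = contradiction (Fin.injective⇒≤ (λ {i} {j} eq → inj
        (Fin.punchOut-injective (λ e → ∄ (i , sym e)) (λ e → ∄ (j , sym e)) eq))) 1+n≰n

val : Vec (Fin n) n → Fin n → ℕ
val τ i = toℕ (lookup τ i)

attains : (τ : Vec (Fin n) n) → IsPermutation τ → ∀ {x} → x < n → ∃[ i ] val τ i ≡ x
attains τ (_ , onto) x<n =
  let i , eq = onto (fromℕ< x<n) in i , trans (cong toℕ (eq refl)) (Fin.toℕ-fromℕ< x<n)

ins : Fin (suc n) → Vec (Fin n) n → Vec (Fin (suc n)) (suc n)
ins y τ = y ∷ map (punchIn y) τ

lookup-ins : ∀ (y : Fin (suc n)) τ i → lookup (ins y τ) (suc i) ≡ punchIn y (lookup τ i)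
lookup-ins y τ i = Vec.lookup-map i (punchIn y) τ

lookup-ext : ∀ {A : Set} {m} {u v : Vec A m} → (∀ i → lookup u i ≡ lookup v i) → u ≡ v
lookup-ext {u = u} {v} eq =
  trans (sym (Vec.tabulate∘lookup u)) (trans (Vec.tabulate-cong eq) (Vec.tabulate∘lookup v))

ins-injective : ∀ {y : Fin (suc n)} {τ τ′} → ins y τ ≡ ins y τ′ → τ ≡ τ′
ins-injective {y = y} {τ} {τ′} eq = lookup-ext λ i → Fin.punchIn-injective y _ _
  (trans (sym (lookup-ins y τ i)) (trans (cong (λ v → lookup v (suc i)) eq) (lookup-ins y τ′ i)))

ins-permutation : ∀ y {τ : Vec (Fin n) n} → IsPermutation τ → IsPermutation (ins y τ)
ins-permutation y {τ} (inj , _) = injective⇒permutation (ins y τ) (ins-inj _ _)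
  where
  ins-inj : ∀ i j → lookup (ins y τ) i ≡ lookup (ins y τ) j → i ≡ j
  ins-inj zero    zero    _  = refl
  ins-inj zero    (suc j) eq = contradiction (sym (trans eq (lookup-ins y τ j))) (Fin.punchInᵢ≢i y _)
  ins-inj (suc i) zero    eq = contradiction (trans (sym (lookup-ins y τ i)) eq) (Fin.punchInᵢ≢i y _)
  ins-inj (suc i) (suc j) eq = cong suc (inj (Fin.punchIn-injective y _ _
    (trans (sym (lookup-ins y τ i)) (trans eq (lookup-ins y τ j)))))

ins-surjective : ∀ {v : Vec (Fin (suc n)) (suc n)} → IsPermutation v →
                 ∃[ τ ] IsPermutation τ × v ≡ ins (head v) τ
ins-surjective {v = y ∷ w} (inj , _) = τ , injective⇒permutation τ τ-inj , lookup-ext same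
  where
  y≢ : ∀ i → y ≢ lookup w i
  y≢ i eq with () ← inj {zero} {suc i} eq
  τ = tabulate (λ i → punchOut (y≢ i))
  lookup-τ : ∀ i → lookup τ i ≡ punchOut (y≢ i)
  lookup-τ = Vec.lookup∘tabulate _
  τ-inj : ∀ {i j} → lookup τ i ≡ lookup τ j → i ≡ j
  τ-inj {i} {j} eq = Fin.suc-injective (inj {suc i} {suc j} (Fin.punchOut-injective (y≢ i) (y≢ j)
    (trans (sym (lookup-τ i)) (trans eq (lookup-τ j)))))
  same : ∀ i → lookup (y ∷ w) i ≡ lookup (ins y τ) i
  same zero    = refl
  same (suc i) = sym (trans (lookup-ins y τ i)
    (trans (cong (punchIn y) (lookup-τ i)) (Fin.punchIn-punchOut (y≢ i))))

Card : (Vec (Fin n) n → Set) → ℕ → Set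
Card Q = HasCardinality (λ τ → IsPermutation τ × Q τ)

Card-cong : ∀ {Q R : Vec (Fin n) n → Set} {k} → (∀ {τ} → IsPermutation τ → Q τ ⇔ R τ) →
            Card Q k → Card R k
Card-cong Q⇔R = card-cong λ τ → mk⇔ (λ (p , q) → p , to (Q⇔R p) q) (λ (p , r) → p , from (Q⇔R p) r)

Card-∅ : ∀ {Q : Vec (Fin n) n → Set} → (∀ {τ} → IsPermutation τ → ¬ Q τ) → Card Q 0
Card-∅ ¬Q = card-∅ λ τ (p , q) → ¬Q p q

Card-[] : ∀ {Q : Vec (Fin 0) 0 → Set} → Q [] → Card Q 1
Card-[] q = ([] ∷ []) , [] ∷ [] ,
  (λ where [] → mk⇔ (λ _ → ((λ { {()} }) , λ ()) , q) (λ _ → here refl)) , refl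

Σ< : ℕ → (ℕ → ℕ) → ℕ
Σ< zero    f = 0
Σ< (suc n) f = Σ< n f + f n

-- A partial count, so that the possible first entries can be treated in consecutive ranges:
-- `upto-Σ` for a range that contributes a sum, `upto-∅` for a forbidden one, `upto-suc` for a
-- single value.
Upto : (Vec (Fin (suc n)) (suc n) → Set) → ℕ → ℕ → Set
Upto Q m = Card (λ τ → Q τ × toℕ (head τ) < m)

module _ {Q : Vec (Fin (suc n)) (suc n) → Set} where

  upto-zero : Upto Q 0 0
  upto-zero = Card-∅ λ _ ()

  upto-suc : ∀ {m X c} (y : Fin (suc n)) → toℕ y ≡ m → Upto Q m X → Card (Q ∘ ins y) c →
             Upto Q (suc m) (X + c)
  upto-suc {m} y refl below at = card-cong cases (card-⊎ disjoint below (card-image (ins y) ins-injective image at))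
    where
    At : Vec (Fin (suc n)) (suc n) → Set
    At v = IsPermutation v × Q v × head v ≡ y
    image : ∀ v → At v ⇔ (∃[ τ ] (IsPermutation τ × Q (ins y τ)) × v ≡ ins y τ)
    image v = mk⇔
      (λ where (p , q , refl) → let τ , pτ , eq = ins-surjective p in τ , (pτ , subst Q eq q) , eq)
      (λ where (τ , (p , q) , refl) → ins-permutation y p , q , refl)
    disjoint : ∀ v → IsPermutation v × Q v × toℕ (head v) < m → ¬ At v
    disjoint v (_ , _ , lt) (_ , _ , refl) = n≮n _ lt
    cases : ∀ v → ((IsPermutation v × Q v × toℕ (head v) < m) ⊎ At v) ⇔
                  (IsPermutation v × Q v × toℕ (head v) < suc m)
    cases v = mk⇔
      (λ where (inj₁ (p , q , lt))   → p , q , m<n⇒m<1+n lt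
               (inj₂ (p , q , refl)) → p , q , n<1+n _)
      (λ where (p , q , lt) → [ (λ lt′ → inj₁ (p , q , lt′)) ,
                                (λ eq → inj₂ (p , q , Fin.toℕ-injective eq)) ]′ (m≤n⇒m<n∨m≡n (s≤s⁻¹ lt)))

  upto-Σ : ∀ {l X} k {c : ℕ → ℕ} → l + k ≤ suc n → Upto Q l X →
           (∀ i → i < k → ∀ y → toℕ y ≡ l + i → Card (Q ∘ ins y) (c i)) → Upto Q (l + k) (X + Σ< k c)
  upto-Σ {l} {X} zero _ U _ = subst₂ (Upto Q) (sym (+-identityʳ l)) (sym (+-identityʳ X)) U
  upto-Σ {l} {X} (suc k) {c} l+k≤n U at = subst₂ (Upto Q) (sym (+-suc l k)) (+-assoc X (Σ< k c) (c k))
    (upto-suc (fromℕ< l+k<n) (Fin.toℕ-fromℕ< l+k<n) (upto-Σ k (<⇒≤ l+k<n) U (λ i i<k → at i (m<n⇒m<1+n i<k)))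
      (at k ≤-refl _ (Fin.toℕ-fromℕ< l+k<n)))
    where l+k<n = subst (_≤ suc n) (+-suc l k) l+k≤n

  upto-∅ : ∀ {l l′ X} → l ≤ l′ → Upto Q l X →
           (∀ {τ} → IsPermutation τ → ∀ y → l ≤ toℕ y → toℕ y < l′ → ¬ Q (ins y τ)) → Upto Q l′ X
  upto-∅ l≤l′ U ∅ = Card-cong (λ {v} p → mk⇔
    (λ (q , lt) → q , <-≤-trans lt l≤l′)
    (λ (q , lt) → q , ≰⇒> λ l≤ → let τ , pτ , eq = ins-surjective p in
                                 ∅ pτ (head v) l≤ lt (subst Q eq q))) U

  upto-full : ∀ {m X} → suc n ≤ m → Upto Q m X → Card Q X
  upto-full n<m = Card-cong λ {v} _ → mk⇔ proj₁ (λ q → q , <-≤-trans (Fin.toℕ<n (head v)) n<m)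

  card-by-head : {c : ℕ → ℕ} → (∀ y → Card (Q ∘ ins y) (c (toℕ y))) → Card Q (Σ< (suc n) c)
  card-by-head {c} at = upto-full ≤-refl (upto-Σ (suc n) ≤-refl upto-zero
    λ where _ _ y refl → at y)

-- Patterns, complementation and reversal

Pat : S₃ → ℕ → ℕ → ℕ → Set
Pat p123 a b c = a < b × b < c
Pat p132 a b c = a < c × c < b
Pat p213 a b c = b < a × a < c
Pat p231 a b c = c < a × a < b
Pat p312 a b c = b < c × c < a
Pat p321 a b c = c < b × b < a

letters-injective : ∀ p s t → lookup (letters p) s ≡ lookup (letters p) t → s ≡ t
letters-injective p = case p
  where
  dec : ∀ p → _
  dec p = Fin.all? λ s → Fin.all? λ t → (lookup (letters p) s ≟ lookup (letters p) t) →-dec (s Fin.≟ t)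
  case : ∀ p s t → lookup (letters p) s ≡ lookup (letters p) t → s ≡ t
  case p123 = toWitness {a? = dec p123} _
  case p132 = toWitness {a? = dec p132} _
  case p213 = toWitness {a? = dec p213} _
  case p231 = toWitness {a? = dec p231} _
  case p312 = toWitness {a? = dec p312} _
  case p321 = toWitness {a? = dec p321} _

-- One direction suffices because the letters are distinct: if the letters at s and t compared the
-- other way, asymmetry would be violated, and if they were equal, s and t would coincide.
sameOrder⁺ : ∀ p {u} → (∀ s t → lookup (letters p) s < lookup (letters p) t → lookup u s < lookup u t) →
             SameRelativeOrder u (letters p)
sameOrder⁺ p {u} mono s t = mk⇔ reflects (mono s t)
  where
  reflects : lookup u s < lookup u t → lookup (letters p) s < lookup (letters p) t
  reflects us<ut with <-cmp (lookup (letters p) s) (lookup (letters p) t)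
  ... | tri< lt _ _ = lt
  ... | tri> _ _ gt = contradiction us<ut (<-asym (mono t s gt))
  ... | tri≈ _ eq _ with refl ← letters-injective p s t eq = contradiction us<ut (n≮n _)

-- The triple and the letters factor through the same vector `rank p`, one via the sorted values x <
-- y < z, the other via 1, 2, 3. This reduces all six patterns to `ascending`.
pat⇒sameOrder : ∀ p {a b c} → Pat p a b c → SameRelativeOrder (suc a ∷ suc b ∷ suc c ∷ []) (letters p)
pat⇒sameOrder p {a} {b} {c} pat = sameOrder⁺ p {u} (mono p pat)
  where
  u = suc a ∷ suc b ∷ suc c ∷ []
  ascending : ∀ {x y z} → x < y × y < z → ∀ i j → suc (toℕ i) < suc (toℕ j) →
              suc (lookup (x ∷ y ∷ z ∷ []) i) < suc (lookup (x ∷ y ∷ z ∷ []) j)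
  ascending (x<y , y<z) 0F 1F _ = s<s x<y
  ascending (x<y , y<z) 0F 2F _ = s<s (<-trans x<y y<z)
  ascending (x<y , y<z) 1F 2F _ = s<s y<z
  ascending _ 0F 0F (s≤s ())
  ascending _ 1F 0F (s≤s ())
  ascending _ 1F 1F (s≤s (s≤s ()))
  ascending _ 2F 0F (s≤s ())
  ascending _ 2F 1F (s≤s (s≤s ()))
  ascending _ 2F 2F (s≤s (s≤s (s≤s ())))
  rank : S₃ → Vec (Fin 3) 3
  rank p123 = 0F ∷ 1F ∷ 2F ∷ []
  rank p132 = 0F ∷ 2F ∷ 1F ∷ []
  rank p213 = 1F ∷ 0F ∷ 2F ∷ []
  rank p231 = 1F ∷ 2F ∷ 0F ∷ []
  rank p312 = 2F ∷ 0F ∷ 1F ∷ []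
  rank p321 = 2F ∷ 1F ∷ 0F ∷ []
  by-rank : ∀ {v r} {x y z} → x < y × y < z → v ≡ Vec.map (suc ∘ toℕ) r →
            u ≡ Vec.map (λ i → suc (lookup (x ∷ y ∷ z ∷ []) i)) r →
            ∀ s t → lookup v s < lookup v t → lookup u s < lookup u t
  by-rank {r = r} {x} {y} {z} xyz refl u≡ s t lt rewrite u≡ =
    subst₂ _<_ (sym (Vec.lookup-map s _ r)) (sym (Vec.lookup-map t _ r))
      (ascending xyz (lookup r s) (lookup r t)
        (subst₂ _<_ (Vec.lookup-map s _ r) (Vec.lookup-map t _ r) lt))
  mono : ∀ p → Pat p a b c → ∀ s t → lookup (letters p) s < lookup (letters p) t → lookup u s < lookup u t
  mono p123 pat = by-rank {r = rank p123} pat refl refl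
  mono p132 pat = by-rank {r = rank p132} pat refl refl
  mono p213 pat = by-rank {r = rank p213} pat refl refl
  mono p231 pat = by-rank {r = rank p231} pat refl refl
  mono p312 pat = by-rank {r = rank p312} pat refl refl
  mono p321 pat = by-rank {r = rank p321} pat refl refl

sameOrder⇒pat : ∀ p {a b c} → SameRelativeOrder (suc a ∷ suc b ∷ suc c ∷ []) (letters p) → Pat p a b c
sameOrder⇒pat p same = go p same
  where
  1<2 : 1 < 2
  1<2 = s≤s (s≤s z≤n)
  2<3 : 2 < 3
  2<3 = s≤s 1<2
  go : ∀ p {a b c} → SameRelativeOrder (suc a ∷ suc b ∷ suc c ∷ []) (letters p) → Pat p a b c
  go p123 same = s<s⁻¹ (from (same 0F 1F) 1<2) , s<s⁻¹ (from (same 1F 2F) 2<3)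
  go p132 same = s<s⁻¹ (from (same 0F 2F) 1<2) , s<s⁻¹ (from (same 2F 1F) 2<3)
  go p213 same = s<s⁻¹ (from (same 1F 0F) 1<2) , s<s⁻¹ (from (same 0F 2F) 2<3)
  go p231 same = s<s⁻¹ (from (same 2F 0F) 1<2) , s<s⁻¹ (from (same 0F 1F) 2<3)
  go p312 same = s<s⁻¹ (from (same 1F 2F) 1<2) , s<s⁻¹ (from (same 2F 0F) 2<3)
  go p321 same = s<s⁻¹ (from (same 2F 1F) 1<2) , s<s⁻¹ (from (same 1F 0F) 2<3)

-- Contains with values counted from 0.
Occurs : Vec (Fin n) n → VincularPattern → Set
Occurs {n} τ (a-bc p) = ∃[ i ] ∃[ j ] ∃[ k ] i Fin.< j × toℕ k ≡ suc (toℕ j) × Pat p (val τ i) (val τ j) (val τ k)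
Occurs {n} τ (ab-c p) = ∃[ i ] ∃[ j ] ∃[ k ] toℕ j ≡ suc (toℕ i) × j Fin.< k × Pat p (val τ i) (val τ j) (val τ k)

contains⇒occurs : ∀ (τ : Vec (Fin n) n) σ → Contains τ σ → Occurs τ σ
contains⇒occurs τ (a-bc p) (i , j , k , l , e , s) = i , j , k , l , e , sameOrder⇒pat p s
contains⇒occurs τ (ab-c p) (i , j , k , e , l , s) = i , j , k , e , l , sameOrder⇒pat p s

occurs⇒contains : ∀ (τ : Vec (Fin n) n) σ → Occurs τ σ → Contains τ σ
occurs⇒contains τ (a-bc p) (i , j , k , l , e , s) = i , j , k , l , e , pat⇒sameOrder p s
occurs⇒contains τ (ab-c p) (i , j , k , e , l , s) = i , j , k , e , l , pat⇒sameOrder p s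

complement₃ : S₃ → S₃
complement₃ p123 = p321
complement₃ p132 = p312
complement₃ p213 = p231
complement₃ p231 = p213
complement₃ p312 = p132
complement₃ p321 = p123

complementᵖ : VincularPattern → VincularPattern
complementᵖ (a-bc p) = a-bc (complement₃ p)
complementᵖ (ab-c p) = ab-c (complement₃ p)

reverse₃ : S₃ → S₃
reverse₃ p123 = p321
reverse₃ p132 = p231
reverse₃ p213 = p312
reverse₃ p231 = p132
reverse₃ p312 = p213
reverse₃ p321 = p123

reverseᵖ : VincularPattern → VincularPattern
reverseᵖ (a-bc p) = ab-c (reverse₃ p)
reverseᵖ (ab-c p) = a-bc (reverse₃ p)

complement reverse : Vec (Fin n) n → Vec (Fin n) n
complement τ = map opposite τ
reverse τ = tabulate (lookup τ ∘ opposite)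

lookup-complement : ∀ (τ : Vec (Fin n) n) i → lookup (complement τ) i ≡ opposite (lookup τ i)
lookup-complement τ i = Vec.lookup-map i opposite τ

lookup-reverse : ∀ (τ : Vec (Fin n) n) i → lookup (reverse τ) i ≡ lookup τ (opposite i)
lookup-reverse τ = Vec.lookup∘tabulate _

opposite-antitone : ∀ {i j : Fin n} → i Fin.< j → opposite j Fin.< opposite i
opposite-antitone {n} {i} {j} i<j rewrite Fin.opposite-prop i | Fin.opposite-prop j =
  ∸-monoʳ-< (s≤s i<j) (Fin.toℕ<n j)

opposite-injective : ∀ {i j : Fin n} → opposite i ≡ opposite j → i ≡ j
opposite-injective {i = i} {j} eq =
  trans (sym (Fin.opposite-involutive i)) (trans (cong opposite eq) (Fin.opposite-involutive j))

opposite-next : ∀ {i j : Fin n} → toℕ j ≡ suc (toℕ i) → toℕ (opposite i) ≡ suc (toℕ (opposite j))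
opposite-next {n} {i} {j} eq rewrite Fin.opposite-prop i | Fin.opposite-prop j | eq = begin
  n ∸ suc (toℕ i)             ≡⟨ +-∸-assoc 1 (subst (_< n) eq (Fin.toℕ<n j)) ⟩
  suc (n ∸ suc (suc (toℕ i))) ∎
  where open ≡-Reasoning

complement-involutive : ∀ (τ : Vec (Fin n) n) → complement (complement τ) ≡ τ
complement-involutive τ = lookup-ext λ i → trans (lookup-complement (complement τ) i)
  (trans (cong opposite (lookup-complement τ i)) (Fin.opposite-involutive _))

reverse-involutive : ∀ (τ : Vec (Fin n) n) → reverse (reverse τ) ≡ τ
reverse-involutive τ = lookup-ext λ i → trans (lookup-reverse (reverse τ) i)
  (trans (lookup-reverse τ _) (cong (lookup τ) (Fin.opposite-involutive i)))

complement-permutation : ∀ (τ : Vec (Fin n) n) → IsPermutation τ → IsPermutation (complement τ)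
complement-permutation τ (inj , _) = injective⇒permutation (complement τ) λ {i} {j} eq →
  inj (opposite-injective (subst₂ _≡_ (lookup-complement τ i) (lookup-complement τ j) eq))

reverse-permutation : ∀ (τ : Vec (Fin n) n) → IsPermutation τ → IsPermutation (reverse τ)
reverse-permutation τ (inj , _) = injective⇒permutation (reverse τ) λ {i} {j} eq →
  opposite-injective (inj (subst₂ _≡_ (lookup-reverse τ i) (lookup-reverse τ j) eq))

pat-complement : ∀ p (x y z : Fin n) → Pat p (toℕ x) (toℕ y) (toℕ z) →
                 Pat (complement₃ p) (toℕ (opposite x)) (toℕ (opposite y)) (toℕ (opposite z))
pat-complement p123 x y z (l , m) = opposite-antitone {i = y} m , opposite-antitone {i = x} l
pat-complement p132 x y z (l , m) = opposite-antitone {i = z} m , opposite-antitone {i = x} l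
pat-complement p213 x y z (l , m) = opposite-antitone {i = x} m , opposite-antitone {i = y} l
pat-complement p231 x y z (l , m) = opposite-antitone {i = x} m , opposite-antitone {i = z} l
pat-complement p312 x y z (l , m) = opposite-antitone {i = z} m , opposite-antitone {i = y} l
pat-complement p321 x y z (l , m) = opposite-antitone {i = y} m , opposite-antitone {i = z} l

pat-reverse : ∀ p {a b c} → Pat p a b c → Pat (reverse₃ p) c b a
pat-reverse p123 = id
pat-reverse p132 = id
pat-reverse p213 = id
pat-reverse p231 = id
pat-reverse p312 = id
pat-reverse p321 = id

occurs-complement : ∀ (τ : Vec (Fin n) n) σ → Occurs τ σ → Occurs (complement τ) (complementᵖ σ)
occurs-complement τ (a-bc p) (i , j , k , l , e , s) = i , j , k , l , e , pat
  where pat : Pat (complement₃ p) (val (complement τ) i) (val (complement τ) j) (val (complement τ) k)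
        pat rewrite lookup-complement τ i | lookup-complement τ j | lookup-complement τ k =
          pat-complement p (lookup τ i) (lookup τ j) (lookup τ k) s
occurs-complement τ (ab-c p) (i , j , k , l , e , s) = i , j , k , l , e , pat
  where pat : Pat (complement₃ p) (val (complement τ) i) (val (complement τ) j) (val (complement τ) k)
        pat rewrite lookup-complement τ i | lookup-complement τ j | lookup-complement τ k =
          pat-complement p (lookup τ i) (lookup τ j) (lookup τ k) s

val-reverse-opposite : ∀ (τ : Vec (Fin n) n) i → val τ i ≡ val (reverse τ) (opposite i)
val-reverse-opposite τ i = cong toℕ (sym (trans (lookup-reverse τ (opposite i))
  (cong (lookup τ) (Fin.opposite-involutive i))))

occurs-reverse : ∀ (τ : Vec (Fin n) n) σ → Occurs τ σ → Occurs (reverse τ) (reverseᵖ σ)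
occurs-reverse τ (a-bc p) (i , j , k , l , e , s) =
  opposite k , opposite j , opposite i , opposite-next {i = j} {k} e , opposite-antitone {i = i} l , pat-reverse p pat
  where pat : Pat p (val (reverse τ) (opposite i)) (val (reverse τ) (opposite j)) (val (reverse τ) (opposite k))
        pat rewrite sym (val-reverse-opposite τ i) | sym (val-reverse-opposite τ j)
                  | sym (val-reverse-opposite τ k) = s
occurs-reverse τ (ab-c p) (i , j , k , e , l , s) =
  opposite k , opposite j , opposite i , opposite-antitone {i = j} l , opposite-next {i = i} {j} e , pat-reverse p pat
  where pat : Pat p (val (reverse τ) (opposite i)) (val (reverse τ) (opposite j)) (val (reverse τ) (opposite k))
        pat rewrite sym (val-reverse-opposite τ i) | sym (val-reverse-opposite τ j)
                  | sym (val-reverse-opposite τ k) = s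

complement₃-involutive : ∀ p → complement₃ (complement₃ p) ≡ p
complement₃-involutive p123 = refl
complement₃-involutive p132 = refl
complement₃-involutive p213 = refl
complement₃-involutive p231 = refl
complement₃-involutive p312 = refl
complement₃-involutive p321 = refl

complementᵖ-involutive : ∀ σ → complementᵖ (complementᵖ σ) ≡ σ
complementᵖ-involutive (a-bc p) = cong a-bc (complement₃-involutive p)
complementᵖ-involutive (ab-c p) = cong ab-c (complement₃-involutive p)

reverse₃-involutive : ∀ p → reverse₃ (reverse₃ p) ≡ p
reverse₃-involutive p123 = refl
reverse₃-involutive p132 = refl
reverse₃-involutive p213 = refl
reverse₃-involutive p231 = refl
reverse₃-involutive p312 = refl
reverse₃-involutive p321 = refl

reverseᵖ-involutive : ∀ σ → reverseᵖ (reverseᵖ σ) ≡ σ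
reverseᵖ-involutive (a-bc p) = cong a-bc (reverse₃-involutive p)
reverseᵖ-involutive (ab-c p) = cong ab-c (reverse₃-involutive p)

-- An occurrence in the complement is complemented once more, which brings it back to τ and σ since
-- both operations are involutions.
avoids-complement : ∀ (τ : Vec (Fin n) n) σ → Avoids τ σ → Avoids (complement τ) (complementᵖ σ)
avoids-complement τ σ av c = av (occurs⇒contains τ σ
  (subst₂ Occurs (complement-involutive τ) (complementᵖ-involutive σ)
    (occurs-complement (complement τ) (complementᵖ σ) (contains⇒occurs (complement τ) (complementᵖ σ) c))))

avoids-reverse : ∀ (τ : Vec (Fin n) n) σ → Avoids τ σ → Avoids (reverse τ) (reverseᵖ σ)
avoids-reverse τ σ av c = av (occurs⇒contains τ σ
  (subst₂ Occurs (reverse-involutive τ) (reverseᵖ-involutive σ)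
    (occurs-reverse (reverse τ) (reverseᵖ σ) (contains⇒occurs (reverse τ) (reverseᵖ σ) c))))

Avoiders : ℕ → VincularPattern → ℕ → Set
Avoiders n σ = Card {n} (λ τ → Avoids τ σ)

card-complement : ∀ {n k} σ → Avoiders n σ k → Avoiders n (complementᵖ σ) k
card-complement σ = card-involution complement complement-involutive
  (λ τ (p , av) → complement-permutation τ p , avoids-complement τ σ av)
  (λ τ (p , av) → complement-permutation τ p ,
    subst (Avoids (complement τ)) (complementᵖ-involutive σ) (avoids-complement τ (complementᵖ σ) av))

card-reverse : ∀ {n k} σ → Avoiders n σ k → Avoiders n (reverseᵖ σ) k
card-reverse σ = card-involution reverse reverse-involutive
  (λ τ (p , av) → reverse-permutation τ p , avoids-reverse τ σ av)
  (λ τ (p , av) → reverse-permutation τ p ,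
    subst (Avoids (reverse τ)) (reverseᵖ-involutive σ) (avoids-reverse τ (reverseᵖ σ) av))

card-S-complement : ∀ {n r k} σ → r ≤ n → HasCardinality (S (suc n) (suc r) σ) k →
                    HasCardinality (S (suc n) (suc (n ∸ r)) (complementᵖ σ)) k
card-S-complement {n} {r} σ r≤n = card-involution complement complement-involutive fwd bwd
  where
  starts : ∀ {r} (τ : Vec (Fin (suc n)) (suc n)) → (∃[ i ] toℕ i ≡ 0 × τ ⟨ i ⟩ ≡ suc r) →
           ∃[ i ] toℕ i ≡ 0 × complement τ ⟨ i ⟩ ≡ suc (n ∸ r)
  starts τ (i , i≡0 , refl) = i , i≡0 , cong suc (trans (cong toℕ (lookup-complement τ i)) (Fin.opposite-prop (lookup τ i)))
  fwd : ∀ τ → S (suc n) (suc r) σ τ → S (suc n) (suc (n ∸ r)) (complementᵖ σ) (complement τ)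
  fwd τ (p , st , av) = complement-permutation τ p , starts τ st , avoids-complement τ σ av
  bwd : ∀ τ → S (suc n) (suc (n ∸ r)) (complementᵖ σ) τ → S (suc n) (suc r) σ (complement τ)
  bwd τ (p , st , av) = complement-permutation τ p ,
    (let i , i≡0 , eq = starts τ st in i , i≡0 , trans eq (cong suc (m∸[m∸n]≡n r≤n))) ,
    subst (Avoids (complement τ)) (complementᵖ-involutive σ) (avoids-complement τ (complementᵖ σ) av)

card-S : ∀ {r k σ} (y : Fin (suc n)) → toℕ y ≡ r → Card (λ τ → Avoids (ins y τ) σ) k →
         HasCardinality (S (suc n) (suc r) σ) k
card-S {n} {r} {σ = σ} y refl = card-image (ins y) ins-injective image
  where
  image : ∀ v → S (suc n) (suc r) σ v ⇔ (∃[ τ ] (IsPermutation τ × Avoids (ins y τ) σ) × v ≡ ins y τ)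
  image (x ∷ v) = mk⇔
    (λ where (p , (zero , _ , eq) , av) → helper (Fin.toℕ-injective (suc-injective eq)) p av)
    (λ where (τ , (p , av) , refl) → ins-permutation y p , (zero , refl , refl) , av)
    where
    helper : x ≡ y → IsPermutation (x ∷ v) → Avoids (x ∷ v) σ →
             ∃[ τ ] (IsPermutation τ × Avoids (ins y τ) σ) × x ∷ v ≡ ins y τ
    helper refl p av = let τ , pτ , eq = ins-surjective p in
                       τ , (pτ , subst (λ w → Avoids w σ) eq av) , eq

-- Deleting the first entry: ab-c patterns

skip : ℕ → ℕ → ℕ
skip zero    x       = suc x
skip (suc y) zero    = zero
skip (suc y) (suc x) = suc (skip y x)

toℕ-punchIn : ∀ (y : Fin (suc n)) x → toℕ (punchIn y x) ≡ skip (toℕ y) (toℕ x)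
toℕ-punchIn zero    x       = refl
toℕ-punchIn (suc y) zero    = refl
toℕ-punchIn (suc y) (suc x) = cong suc (toℕ-punchIn y x)

val-ins : ∀ (y : Fin (suc n)) τ i → val (ins y τ) (suc i) ≡ skip (toℕ y) (val τ i)
val-ins y τ i = trans (cong toℕ (lookup-ins y τ i)) (toℕ-punchIn y _)

skip-below : ∀ {y x} → x < y → skip y x ≡ x
skip-below {suc y} {zero}  _         = refl
skip-below {suc y} {suc x} (s<s x<y) = cong suc (skip-below x<y)

skip-above : ∀ {y x} → y ≤ x → skip y x ≡ suc x
skip-above {zero}          _         = refl
skip-above {suc y} {suc x} (s≤s y≤x) = cong suc (skip-above y≤x)

skip-mono-< : ∀ y {x x′} → x < x′ → skip y x < skip y x′
skip-mono-< zero                     x<x′       = s<s x<x′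
skip-mono-< (suc y) {zero}  {suc x′} _          = z<s
skip-mono-< (suc y) {suc x} {suc x′} (s<s x<x′) = s<s (skip-mono-< y x<x′)

skip-cancel-< : ∀ y {x x′} → skip y x < skip y x′ → x < x′
skip-cancel-< zero                     (s<s x<x′) = x<x′
skip-cancel-< (suc y) {zero}  {suc x′} _          = z<s
skip-cancel-< (suc y) {suc x} {suc x′} (s<s x<x′) = s<s (skip-cancel-< y x<x′)

-- For a threshold t ≤ y, making room for y does not move any value across t; this and the next
-- three lemmas carry threshold conditions through a deletion. At y itself the strict comparison
-- becomes a weak one (`skip->`, `>-skip`), because the value y is left free.
skip-< : ∀ {t} y {x} → t ≤ y → skip y x < t → x < t
skip-< zero            z≤n       ()
skip-< (suc y) {zero}  (s≤s _)   _       = z<s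
skip-< (suc y) {suc x} (s≤s t≤y) (s<s p) = s<s (skip-< y t≤y p)

<-skip : ∀ {t} y {x} → t ≤ y → x < t → skip y x < t
<-skip y t≤y x<t rewrite skip-below (<-≤-trans x<t t≤y) = x<t

skip-≥ : ∀ {t} y {x} → t ≤ y → t ≤ skip y x → t ≤ x
skip-≥ y t≤y t≤ = ≮⇒≥ λ x<t → ≤⇒≯ t≤ (<-skip y t≤y x<t)

≥-skip : ∀ {t} y {x} → t ≤ y → t ≤ x → t ≤ skip y x
≥-skip y t≤y t≤x = ≮⇒≥ λ p → ≤⇒≯ t≤x (skip-< y t≤y p)

skip-> : ∀ y {x} → y < skip y x → y ≤ x
skip-> y {x} y< = ≮⇒≥ λ x<y → <-asym x<y (subst (y <_) (skip-below x<y) y<)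

>-skip : ∀ y {x} → y ≤ x → y < skip y x
>-skip y y≤x rewrite skip-above y≤x = s≤s y≤x

pat-map : ∀ p {f : ℕ → ℕ} → (∀ {x y} → x < y → f x < f y) → ∀ {a b c} → Pat p a b c → Pat p (f a) (f b) (f c)
pat-map p123 f< (l , m) = f< l , f< m
pat-map p132 f< (l , m) = f< l , f< m
pat-map p213 f< (l , m) = f< l , f< m
pat-map p231 f< (l , m) = f< l , f< m
pat-map p312 f< (l , m) = f< l , f< m
pat-map p321 f< (l , m) = f< l , f< m

pat-unmap : ∀ p {f : ℕ → ℕ} → (∀ {x y} → f x < f y → x < y) → ∀ {a b c} → Pat p (f a) (f b) (f c) → Pat p a b c
pat-unmap p123 f< (l , m) = f< l , f< m
pat-unmap p132 f< (l , m) = f< l , f< m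
pat-unmap p213 f< (l , m) = f< l , f< m
pat-unmap p231 f< (l , m) = f< l , f< m
pat-unmap p312 f< (l , m) = f< l , f< m
pat-unmap p321 f< (l , m) = f< l , f< m

module _ (p : S₃) (y : Fin (suc n)) (τ : Vec (Fin n) n) where

  pat-ins : ∀ i j k → Pat p (val τ i) (val τ j) (val τ k) →
            Pat p (val (ins y τ) (suc i)) (val (ins y τ) (suc j)) (val (ins y τ) (suc k))
  pat-ins i j k pat rewrite val-ins y τ i | val-ins y τ j | val-ins y τ k = pat-map p (skip-mono-< (toℕ y)) pat

  pat-ins⁻ : ∀ i j k → Pat p (val (ins y τ) (suc i)) (val (ins y τ) (suc j)) (val (ins y τ) (suc k)) →
             Pat p (val τ i) (val τ j) (val τ k)
  pat-ins⁻ i j k pat rewrite val-ins y τ i | val-ins y τ j | val-ins y τ k = pat-unmap p (skip-cancel-< (toℕ y)) pat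

-- A deleted entry that could play the a of `a-bc` restricts the rest only through its adjacent
-- pairs, which is a `NoAdjacent` condition. Deleting a first entry under such a condition leaves a
-- `Head` condition on its successor.
record NoAdjacent (R : ℕ → ℕ → Set) (τ : Vec (Fin n) n) : Set where
  constructor noAdjacent
  field excludes : ∀ j k → toℕ k ≡ suc (toℕ j) → ¬ R (val τ j) (val τ k)

record Head (H : ℕ → Set) (τ : Vec (Fin n) n) : Set where
  constructor head-is
  field satisfies : ∀ i → toℕ i ≡ 0 → H (val τ i)

open NoAdjacent
open Head

NoAdjacent-mono : ∀ {R R′ : ℕ → ℕ → Set} {τ : Vec (Fin n) n} → (∀ {x x′} → R′ x x′ → R x x′) →
                  NoAdjacent R τ → NoAdjacent R′ τ
NoAdjacent-mono R′⇒R na = noAdjacent λ j k e r → excludes na j k e (R′⇒R r)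

NoAdjacent-ins : ∀ {R : ℕ → ℕ → Set} (y : Fin (suc n)) (τ : Vec (Fin n) n) →
  NoAdjacent R (ins y τ) ⇔
  (Head (λ s → ¬ R (toℕ y) (skip (toℕ y) s)) τ × NoAdjacent (λ x x′ → R (skip (toℕ y) x) (skip (toℕ y) x′)) τ)
NoAdjacent-ins {n} {R} y τ = mk⇔
  (λ (noAdjacent na) →
    head-is (λ i i≡0 → na zero (suc i) (cong suc i≡0) ∘ subst (R (toℕ y)) (sym (val-ins y τ i))) ,
    noAdjacent (λ j k e → na (suc j) (suc k) (cong suc e) ∘ subst₂ R (sym (val-ins y τ j)) (sym (val-ins y τ k))))
  (λ (head-is h , noAdjacent na) → noAdjacent λ where
    zero    (suc k) e → h k (suc-injective e) ∘ subst (R (toℕ y)) (val-ins y τ k)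
    (suc j) (suc k) e → na j k (suc-injective e) ∘ subst₂ R (val-ins y τ j) (val-ins y τ k))

avoids-a-bc-ins : ∀ p (y : Fin (suc n)) (τ : Vec (Fin n) n) →
  Avoids (ins y τ) (a-bc p) ⇔
  (Avoids τ (a-bc p) × NoAdjacent (λ x x′ → Pat p (toℕ y) (skip (toℕ y) x) (skip (toℕ y) x′)) τ)
avoids-a-bc-ins {n} p y τ = mk⇔
  (λ av → (λ c → let i , j , k , l , e , pat = contains⇒occurs τ (a-bc p) c in
                 av (occurs⇒contains (ins y τ) (a-bc p) (suc i , suc j , suc k , s<s l , cong suc e , pat-ins p y τ i j k pat))) ,
          noAdjacent (λ j k e pat → av (occurs⇒contains (ins y τ) (a-bc p) (zero , suc j , suc k , z<s , cong suc e ,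
             subst₂ (Pat p (toℕ y)) (sym (val-ins y τ j)) (sym (val-ins y τ k)) pat))))
  (λ (av , na) c → go av na (contains⇒occurs (ins y τ) (a-bc p) c))
  where
  go : Avoids τ (a-bc p) → NoAdjacent (λ x x′ → Pat p (toℕ y) (skip (toℕ y) x) (skip (toℕ y) x′)) τ →
       ¬ Occurs (ins y τ) (a-bc p)
  go av na (zero  , suc j , suc k , _     , e , pat) =
    excludes na j k (suc-injective e) (subst₂ (Pat p (toℕ y)) (val-ins y τ j) (val-ins y τ k) pat)
  go av na (suc i , suc j , suc k , s<s l , e , pat) =
    av (occurs⇒contains τ (a-bc p) (i , j , k , l , suc-injective e , pat-ins⁻ p y τ i j k pat))

-- An occurrence that uses the first entry must use the second one too, and its last letter may
-- stand anywhere later. As τ is a permutation, every z < n does occur there, so the extra condition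
-- depends on y and s alone.
avoids-ab-c-ins : ∀ p (y : Fin (suc (suc n))) (s : Fin (suc n)) (τ : Vec (Fin n) n) → IsPermutation τ →
  Avoids (ins y (ins s τ)) (ab-c p) ⇔
  (Avoids (ins s τ) (ab-c p) ×
   (∀ z → z < n → ¬ Pat p (toℕ y) (skip (toℕ y) (toℕ s)) (skip (toℕ y) (skip (toℕ s) z))))
avoids-ab-c-ins {n} p y s τ perm = mk⇔
  (λ av → (λ c → let i , j , k , e , l , pat = contains⇒occurs (ins s τ) (ab-c p) c in
                 av (occurs⇒contains (ins y (ins s τ)) (ab-c p) (suc i , suc j , suc k , cong suc e , s<s l , pat-ins p y (ins s τ) i j k pat))) ,
          (λ z z<n pat → let i , eq = attains τ perm z<n in
                 av (occurs⇒contains (ins y (ins s τ)) (ab-c p) (zero , suc zero , suc (suc i) , refl , s<s z<s ,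
                   subst₂ (Pat p (toℕ y)) (sym (val-ins y (ins s τ) zero))
                     (sym (trans (third i) (cong (skip (toℕ y) ∘ skip (toℕ s)) eq))) pat))))
  (λ (av , free) c → go av free (contains⇒occurs (ins y (ins s τ)) (ab-c p) c))
  where
  third : ∀ i → val (ins y (ins s τ)) (suc (suc i)) ≡ skip (toℕ y) (skip (toℕ s) (val τ i))
  third i = trans (val-ins y (ins s τ) (suc i)) (cong (skip (toℕ y)) (val-ins s τ i))
  go : Avoids (ins s τ) (ab-c p) →
       (∀ z → z < n → ¬ Pat p (toℕ y) (skip (toℕ y) (toℕ s)) (skip (toℕ y) (skip (toℕ s) z))) →
       ¬ Occurs (ins y (ins s τ)) (ab-c p)
  go av free (zero , suc zero , suc (suc k) , _ , _ , pat) = free _ (Fin.toℕ<n (lookup τ k))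
    (subst₂ (Pat p (toℕ y)) (val-ins y (ins s τ) zero) (third k) pat)
  go av free (zero , suc zero , suc zero , _ , s<s () , _)
  go av free (suc i , suc j , suc k , e , s<s l , pat) =
    av (occurs⇒contains (ins s τ) (ab-c p) (i , j , k , suc-injective e , l , pat-ins⁻ p y (ins s τ) i j k pat))

avoids-singleton : ∀ {y} σ → Avoids (ins {0} y []) σ
avoids-singleton (a-bc _) (zero , zero , _ , () , _)
avoids-singleton (ab-c _) (zero , zero , _ , () , _)

module _ (p : S₃) where

  Starting : ∀ n → Fin (suc n) → Vec (Fin n) n → Set
  Starting n y τ = Avoids (ins y τ) (ab-c p)

  -- Together with `starting-bad` this is a dichotomy: a pair y, s that no remaining value completes
  -- admits all continuations of s, any other pair admits none. Each recurrence is therefore a sum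
  -- over the good s.
  starting-good : ∀ {k} (y : Fin (suc (suc n))) (s : Fin (suc n)) →
    (∀ z → z < n → ¬ Pat p (toℕ y) (skip (toℕ y) (toℕ s)) (skip (toℕ y) (skip (toℕ s) z))) →
    Card (Starting n s) k → Card (Starting (suc n) y ∘ ins s) k
  starting-good y s free = Card-cong λ {τ} perm →
    mk⇔ (λ av → from (avoids-ab-c-ins p y s τ perm) (av , free)) (proj₁ ∘ to (avoids-ab-c-ins p y s τ perm))

  starting-bad : ∀ {τ : Vec (Fin n) n} → IsPermutation τ → (y : Fin (suc (suc n))) (s : Fin (suc n)) → ∀ {z} → z < n →
    Pat p (toℕ y) (skip (toℕ y) (toℕ s)) (skip (toℕ y) (skip (toℕ s) z)) → ¬ Starting (suc n) y (ins s τ)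
  starting-bad {τ = τ} perm y s z<n pat av = proj₂ (to (avoids-ab-c-ins p y s τ perm) av) _ z<n pat

  card-starting-zero : ∀ y → Card (Starting 0 y) 1
  card-starting-zero y = Card-[] (avoids-singleton (ab-c p))

-- Row n, entry y of these triangles counts the avoiders in S_{n+1} with first entry y + 1.
#12-3 #13-2 #23-1 : ℕ → ℕ → ℕ
#12-3 zero    _       = 1
#12-3 (suc n) y       = Σ< (y ⊓ n) (#12-3 n) + #12-3 n n
#13-2 zero    _       = 1
#13-2 (suc n) y       = Σ< (suc (y ⊓ n)) (#13-2 n)
#23-1 zero    _       = 1
#23-1 (suc n) zero    = Σ< (suc n) (#23-1 n)
#23-1 (suc n) (suc y) = Σ< (suc y) (#23-1 n)

-- A descent is harmless; an ascent is harmless only if it reaches the maximum, which is s = n. The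
-- cap y ⊓ n keeps this term from being counted twice when y = n + 1.
card-12-3 : ∀ n y → Card (λ (τ : Vec (Fin n) n) → Avoids (ins y τ) (ab-c p123)) (#12-3 n (toℕ y))
card-12-3 zero    y = card-starting-zero p123 y
card-12-3 (suc n) y =
  upto-full ≤-refl (upto-suc (fromℕ n) (Fin.toℕ-fromℕ n)
    (upto-∅ (m⊓n≤n (toℕ y) n)
      (upto-Σ (toℕ y ⊓ n) (≤-trans (m⊓n≤n (toℕ y) n) (n≤1+n n)) upto-zero
        λ where i i< s refl → starting-good p123 y s
                                (λ _ z<n (l , _) → ≤⇒≯ (skip-> (toℕ y) l) (<-≤-trans i< (m⊓n≤m _ n)))
                                (card-12-3 n s))
      λ perm s y⊓n≤s s<n → bad perm s (≮⇒≥ λ s<y → ≤⇒≯ y⊓n≤s (⊓-glb s<y s<n)) s<n)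
    (starting-good p123 y (fromℕ n) (λ _ z<n (_ , m) → top z<n (skip-cancel-< (toℕ y) m))
      (subst (Card _) (cong (#12-3 n) (Fin.toℕ-fromℕ n)) (card-12-3 n (fromℕ n)))))
  where
  top : ∀ {z} → z < n → ¬ toℕ (fromℕ n) < skip (toℕ (fromℕ n)) z
  top z<n lt rewrite Fin.toℕ-fromℕ n = ≤⇒≯ (skip-> n lt) z<n
  bad : ∀ {τ} → IsPermutation τ → ∀ s → toℕ y ≤ toℕ s → toℕ s < n → ¬ Avoids (ins y (ins s τ)) (ab-c p123)
  -- The witness is z = s: once s is inserted it becomes s + 1, the next larger value.
  bad perm s y≤s s<n = starting-bad p123 perm y s s<n
    (>-skip (toℕ y) y≤s , skip-mono-< (toℕ y) (>-skip (toℕ s) ≤-refl))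

-- An ascent is harmless only if no value lies strictly between its ends, since such a value would
-- come later. In standardised values the ascent by one is s = y, hence the sum includes s = y; for
-- s > y the witness is z = y, which becomes y + 1.
card-13-2 : ∀ n y → Card (λ (τ : Vec (Fin n) n) → Avoids (ins y τ) (ab-c p132)) (#13-2 n (toℕ y))
card-13-2 zero    y = card-starting-zero p132 y
card-13-2 (suc n) y =
  upto-full ≤-refl (upto-∅ (s≤s (m⊓n≤n (toℕ y) n))
    (upto-Σ (suc (toℕ y ⊓ n)) (s≤s (m⊓n≤n (toℕ y) n)) upto-zero
      λ where i (s≤s i≤) s refl → starting-good p132 y s (good s (≤-trans i≤ (m⊓n≤m _ n))) (card-13-2 n s))
    λ perm s y⊓n<s s≤n → bad perm s (≰⇒> λ s≤y → ≤⇒≯ (⊓-glb s≤y (s≤s⁻¹ s≤n)) y⊓n<s))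
  where
  good : ∀ s → toℕ s ≤ toℕ y → ∀ z → z < n →
         ¬ Pat p132 (toℕ y) (skip (toℕ y) (toℕ s)) (skip (toℕ y) (skip (toℕ s) z))
  good s s≤y _ z<n (l , m) = ≤⇒≯ (≤-trans s≤y (skip-> (toℕ y) l)) (skip-cancel-< (toℕ y) m)
  bad : ∀ {τ} → IsPermutation τ → ∀ s → toℕ y < toℕ s → ¬ Avoids (ins y (ins s τ)) (ab-c p132)
  bad perm s y<s = starting-bad p132 perm y s {toℕ y} (<-≤-trans y<s (s≤s⁻¹ (Fin.toℕ<n s)))
    (>-skip (toℕ y) (≥-skip (toℕ s) (<⇒≤ y<s) ≤-refl) , skip-mono-< (toℕ y) (<-skip (toℕ s) ≤-refl y<s))

-- Every ascent from y > 0 is completed by the smallest value, which is still to come. If y is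
-- itself the smallest value nothing can complete it, so all s are allowed.
card-23-1 : ∀ n y → Card (λ (τ : Vec (Fin n) n) → Avoids (ins y τ) (ab-c p231)) (#23-1 n (toℕ y))
card-23-1 zero    y    = card-starting-zero p231 y
card-23-1 (suc n) zero = card-by-head λ s → starting-good p231 zero s (λ { _ _ (() , _) }) (card-23-1 n s)
card-23-1 (suc n) y@(suc y′) =
  upto-full ≤-refl (upto-∅ (Fin.toℕ<n y′)
    (upto-Σ (toℕ y) (Fin.toℕ<n y′) upto-zero
      λ where i i<y s refl → starting-good p231 y s
                               (λ _ _ (_ , m) → ≤⇒≯ (skip-> (toℕ y) m) i<y) (card-23-1 n s))
    λ perm s y≤s s≤n → bad perm s y≤s)
  where
  bad : ∀ {τ} → IsPermutation τ → ∀ s → toℕ y ≤ toℕ s → ¬ Avoids (ins y (ins s τ)) (ab-c p231)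
  bad perm s y≤s = starting-bad p231 perm y s {0} (<-≤-trans z<s (≤-trans y≤s (s≤s⁻¹ (Fin.toℕ<n s))))
    (<-skip (toℕ y) ≤-refl (<-≤-trans (subst (_< toℕ y) (sym (skip-below (<-≤-trans z<s y≤s))) z<s) ≤-refl) ,
     >-skip (toℕ y) y≤s)

-- Deleting the first entry: a-bc patterns

Σ<-cong : ∀ k {f g : ℕ → ℕ} → (∀ i → i < k → f i ≡ g i) → Σ< k f ≡ Σ< k g
Σ<-cong zero    _  = refl
Σ<-cong (suc k) eq = cong₂ _+_ (Σ<-cong k (λ i i<k → eq i (m<n⇒m<1+n i<k))) (eq k ≤-refl)

Σ<-shift : ∀ k (f : ℕ → ℕ) → Σ< (suc k) f ≡ f 0 + Σ< k (f ∘ suc)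
Σ<-shift zero    f = +-comm 0 (f 0)
Σ<-shift (suc k) f = trans (cong (_+ f (suc k)) (Σ<-shift k f)) (+-assoc (f 0) _ _)

Σ<-reverse : ∀ k (f : ℕ → ℕ) → Σ< k (λ i → f (k ∸ suc i)) ≡ Σ< k f
Σ<-reverse zero    f = refl
Σ<-reverse (suc k) f = trans (Σ<-shift k (λ i → f (k ∸ i)))
  (trans (+-comm (f k) _) (cong (_+ f k) (Σ<-reverse k f)))

Σ<-*ʳ : ∀ k (f : ℕ → ℕ) c → Σ< k (λ i → f i * c) ≡ Σ< k f * c
Σ<-*ʳ zero    f c = refl
Σ<-*ʳ (suc k) f c = trans (cong (_+ f k * c) (Σ<-*ʳ k f c)) (sym (*-distribʳ-+ c (Σ< k f) (f k)))

avoids-[] : ∀ σ → Avoids {0} [] σ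
avoids-[] (a-bc _) (() , _)
avoids-[] (ab-c _) (() , _)

-- An avoider of 1-23 or 1-32 is a sequence of monotone runs, each starting at a left-to-right minimum.
-- m values remain below the current minimum and j values may still continue the current run.
#1-bc : ℕ → ℕ → ℕ → ℕ
#1-bc zero    m j = 1
#1-bc (suc n) m j = Σ< m (λ y → #1-bc n y (n ∸ y)) + Σ< j (#1-bc n m)

-- Values from m on lie above the current minimum and must not form ascents, so runs descend: the
-- next entry is a new minimum below m or one of the j values between m and the last entry. Only the
-- latest minimum is remembered, because its condition implies those of the earlier, larger minima.
Run-1-23 : ∀ n → ℕ → ℕ → Vec (Fin n) n → Set
Run-1-23 n m j τ = Avoids τ (a-bc p123) × NoAdjacent (λ x x′ → m ≤ x × x < x′) τ × Head (_< m + j) τ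

card-run-1-23 : ∀ n m j → m + j ≤ n → Card (Run-1-23 n m j) (#1-bc n m j)
card-run-1-23 zero    m j _     = Card-[] (avoids-[] (a-bc p123) , noAdjacent (λ ()) , head-is λ ())
card-run-1-23 (suc n) m j m+j≤n =
  upto-full ≤-refl (upto-∅ m+j≤n
    (upto-Σ j m+j≤n (upto-Σ m (≤-trans (m≤m+n m j) m+j≤n) upto-zero
      λ where _ y<m y refl → Card-cong (λ _ → new-run y y<m) (card-run-1-23 n (toℕ y) (n ∸ toℕ y)
                (≤-reflexive (m+[n∸m]≡n (y≤n y)))))
      λ i i<j y y≡ → Card-cong (λ _ → same-run y y≡ i<j)
        (card-run-1-23 n m i (≤-trans (≤-reflexive (sym y≡)) (y≤n y))))
    λ _ y m+j≤y _ (_ , _ , h) → ≤⇒≯ m+j≤y (satisfies h zero refl))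
  where
  y≤n : ∀ (y : Fin (suc n)) → toℕ y ≤ n
  y≤n y = s≤s⁻¹ (Fin.toℕ<n y)
  new-run : ∀ y → toℕ y < m → ∀ {τ} → Run-1-23 n (toℕ y) (n ∸ toℕ y) τ ⇔ Run-1-23 (suc n) m j (ins y τ)
  new-run y y<m {τ} = mk⇔
    (λ (av , na , _) →
      from (avoids-a-bc-ins p123 y τ) (av , NoAdjacent-mono
        (λ (l , r) → skip-> (toℕ y) l , skip-cancel-< (toℕ y) r) na) ,
      from (NoAdjacent-ins y τ) (head-is (λ _ _ (m≤y , _) → ≤⇒≯ m≤y y<m) , NoAdjacent-mono
        (λ (l , r) → skip-> (toℕ y) (<-≤-trans y<m l) , skip-cancel-< (toℕ y) r) na) ,
      head-is λ where zero _ → <-≤-trans y<m (m≤m+n m j))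
    (λ (av , _ , _) → let av′ , na = to (avoids-a-bc-ins p123 y τ) av in
      av′ , NoAdjacent-mono (λ (l , r) → >-skip (toℕ y) l , skip-mono-< (toℕ y) r) na ,
      head-is λ i _ → <-≤-trans (Fin.toℕ<n (lookup τ i)) (≤-reflexive (sym (m+[n∸m]≡n (y≤n y)))))
  same-run : ∀ y {i} → toℕ y ≡ m + i → i < j → ∀ {τ} → Run-1-23 n m i τ ⇔ Run-1-23 (suc n) m j (ins y τ)
  same-run y {i} y≡ i<j {τ} = mk⇔
    (λ (av , na , h) →
      from (avoids-a-bc-ins p123 y τ) (av , NoAdjacent-mono
        (λ (l , r) → ≤-trans m≤y (skip-> (toℕ y) l) , skip-cancel-< (toℕ y) r) na) ,
      from (NoAdjacent-ins y τ) (head-is (λ k e (_ , r) → ≤⇒≯ (≤-trans (≤-reflexive (sym y≡)) (skip-> (toℕ y) r)) (satisfies h k e)) ,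
        NoAdjacent-mono (λ (l , r) → skip-≥ (toℕ y) m≤y l , skip-cancel-< (toℕ y) r) na) ,
      head-is λ where zero _ → ≤-<-trans (≤-reflexive y≡) (+-monoʳ-< m i<j))
    (λ (av , na , _) → let av′ , _ = to (avoids-a-bc-ins p123 y τ) av
                           h , na′ = to (NoAdjacent-ins y τ) na in
      av′ , NoAdjacent-mono (λ (l , r) → ≥-skip (toℕ y) m≤y l , skip-mono-< (toℕ y) r) na′ ,
      head-is λ k e → <-≤-trans (≰⇒> λ y≤s → satisfies h k e (m≤y , >-skip (toℕ y) y≤s)) (≤-reflexive y≡))
    where m≤y = ≤-trans (m≤m+n m i) (≤-reflexive (sym y≡))

-- Here runs ascend: the run may continue with any of the n ∸ l values from l on, and a larger
-- choice leaves fewer of them. The sum thus appears backwards and `reindex` turns it into that of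
-- 1-23.
Run-1-32 : ∀ n → ℕ → ℕ → Vec (Fin n) n → Set
Run-1-32 n m l τ = Avoids τ (a-bc p132) × NoAdjacent (λ x x′ → m ≤ x′ × x′ < x) τ × Head (λ s → s < m ⊎ l ≤ s) τ

card-run-1-32 : ∀ n m l → m ≤ l → l ≤ n → Card (Run-1-32 n m l) (#1-bc n m (n ∸ l))
card-run-1-32 zero    m l _   _   = Card-[] (avoids-[] (a-bc p132) , noAdjacent (λ ()) , head-is λ ())
card-run-1-32 (suc n) m l m≤l l≤n =
  subst (λ k → Card (Run-1-32 (suc n) m l) (Σ< m (λ y → #1-bc n y (n ∸ y)) + k)) reindex
    (upto-full (≤-reflexive (sym l+))
      (upto-Σ (suc n ∸ l) {λ i → #1-bc n m (n ∸ (l + i))} (≤-reflexive l+)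
        (upto-∅ m≤l (upto-Σ m (≤-trans m≤l l≤n) upto-zero
          λ where _ y<m y refl → Card-cong (λ _ → new-run y y<m) (card-run-1-32 n (toℕ y) (toℕ y) ≤-refl (y≤n y)))
          λ _ y m≤y y<l (_ , _ , h) → [ ≤⇒≯ m≤y , <⇒≱ y<l ]′ (satisfies h zero refl))
        λ i _ y y≡ → Card-cong (λ _ → same-run y y≡) (subst (λ k → Card (Run-1-32 n m (toℕ y)) (#1-bc n m (n ∸ k))) y≡
          (card-run-1-32 n m (toℕ y) (≤-trans m≤l (l≤y y y≡)) (y≤n y)))))
  where
  l+ : l + (suc n ∸ l) ≡ suc n
  l+ = m+[n∸m]≡n l≤n
  reindex : Σ< (suc n ∸ l) (λ i → #1-bc n m (n ∸ (l + i))) ≡ Σ< (suc n ∸ l) (#1-bc n m)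
  reindex = trans (Σ<-cong (suc n ∸ l) λ i _ → cong (#1-bc n m)
    (trans (cong (suc n ∸_) (sym (+-suc l i))) (sym (∸-+-assoc (suc n) l (suc i))))) (Σ<-reverse (suc n ∸ l) (#1-bc n m))
  y≤n : ∀ (y : Fin (suc n)) → toℕ y ≤ n
  y≤n y = s≤s⁻¹ (Fin.toℕ<n y)
  l≤y : ∀ (y : Fin (suc n)) {i} → toℕ y ≡ l + i → l ≤ toℕ y
  l≤y y {i} y≡ = ≤-trans (m≤m+n l i) (≤-reflexive (sym y≡))
  new-run : ∀ y → toℕ y < m → ∀ {τ} → Run-1-32 n (toℕ y) (toℕ y) τ ⇔ Run-1-32 (suc n) m l (ins y τ)
  new-run y y<m {τ} = mk⇔
    (λ (av , na , _) →
      from (avoids-a-bc-ins p132 y τ) (av , NoAdjacent-mono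
        (λ (b , r) → skip-> (toℕ y) b , skip-cancel-< (toℕ y) r) na) ,
      from (NoAdjacent-ins y τ) (head-is (λ _ _ (b , r) → <-asym y<m (≤-<-trans b r)) , NoAdjacent-mono
        (λ (b , r) → skip-> (toℕ y) (<-≤-trans y<m b) , skip-cancel-< (toℕ y) r) na) ,
      head-is λ where zero _ → inj₁ y<m)
    (λ (av , _ , _) → let av′ , na = to (avoids-a-bc-ins p132 y τ) av in
      av′ , NoAdjacent-mono (λ (b , r) → >-skip (toℕ y) b , skip-mono-< (toℕ y) r) na ,
      head-is λ i _ → <-≤-connex _ _)
  same-run : ∀ y {i} → toℕ y ≡ l + i → ∀ {τ} → Run-1-32 n m (toℕ y) τ ⇔ Run-1-32 (suc n) m l (ins y τ)
  same-run y y≡ {τ} = mk⇔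
    (λ (av , na , h) →
      from (avoids-a-bc-ins p132 y τ) (av , NoAdjacent-mono
        (λ (b , r) → ≤-trans m≤y (skip-> (toℕ y) b) , skip-cancel-< (toℕ y) r) na) ,
      from (NoAdjacent-ins y τ) (head-is (λ k e (b , r) → [ ≤⇒≯ (skip-≥ (toℕ y) m≤y b) , <⇒≱ (skip-< (toℕ y) ≤-refl r) ]′ (satisfies h k e)) ,
        NoAdjacent-mono (λ (b , r) → skip-≥ (toℕ y) m≤y b , skip-cancel-< (toℕ y) r) na) ,
      head-is λ where zero _ → inj₂ (l≤y y y≡))
    (λ (av , na , _) → let av′ , _ = to (avoids-a-bc-ins p132 y τ) av
                           h , na′ = to (NoAdjacent-ins y τ) na in
      av′ , NoAdjacent-mono (λ (b , r) → ≥-skip (toℕ y) m≤y b , skip-mono-< (toℕ y) r) na′ ,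
      head-is λ k e → [ inj₁ , (λ m≤s → inj₂ (≮⇒≥ λ s<y → satisfies h k e (≥-skip (toℕ y) m≤y m≤s , <-skip (toℕ y) ≤-refl s<y))) ]′
                (<-≤-connex _ m))
    where m≤y = ≤-trans m≤l (l≤y y y≡)

card-1-23 : ∀ n y → Card (λ (τ : Vec (Fin n) n) → Avoids (ins y τ) (a-bc p123)) (#1-bc n (toℕ y) (n ∸ toℕ y))
card-1-23 n y = Card-cong (λ {τ} _ → mk⇔
    (λ (av , na , _) → from (avoids-a-bc-ins p123 y τ) (av , NoAdjacent-mono
      (λ (l , r) → skip-> (toℕ y) l , skip-cancel-< (toℕ y) r) na))
    (λ av → let av′ , na = to (avoids-a-bc-ins p123 y τ) av in
      av′ , NoAdjacent-mono (λ (l , r) → >-skip (toℕ y) l , skip-mono-< (toℕ y) r) na ,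
      head-is λ i _ → <-≤-trans (Fin.toℕ<n (lookup τ i)) (≤-reflexive (sym y+))))
  (card-run-1-23 n (toℕ y) (n ∸ toℕ y) (≤-reflexive y+))
  where y+ = m+[n∸m]≡n (s≤s⁻¹ (Fin.toℕ<n y))

card-1-32 : ∀ n y → Card (λ (τ : Vec (Fin n) n) → Avoids (ins y τ) (a-bc p132)) (#1-bc n (toℕ y) (n ∸ toℕ y))
card-1-32 n y = Card-cong (λ {τ} _ → mk⇔
    (λ (av , na , _) → from (avoids-a-bc-ins p132 y τ) (av , NoAdjacent-mono
      (λ (b , r) → skip-> (toℕ y) b , skip-cancel-< (toℕ y) r) na))
    (λ av → let av′ , na = to (avoids-a-bc-ins p132 y τ) av in
      av′ , NoAdjacent-mono (λ (b , r) → >-skip (toℕ y) b , skip-mono-< (toℕ y) r) na ,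
      head-is λ i _ → <-≤-connex _ _))
  (card-run-1-32 n (toℕ y) (toℕ y) ≤-refl (s≤s⁻¹ (Fin.toℕ<n y)))

-- In an avoider of 2-13 everything above an entry t comes before everything below it;
-- the earlier entries thus leave behind cuts t of the remaining sequence.
Cuts : ∀ n → List ℕ → Vec (Fin n) n → Set
Cuts n ts τ = Avoids τ (a-bc p213) × All (λ t → NoAdjacent (λ x x′ → x < t × t ≤ x′) τ) ts

Descending : ℕ → List ℕ → Set
Descending n []       = ⊤
Descending n (t ∷ ts) = t ≤ n × Descending t ts

-- z replaces an empty sum: a cut with nothing above it imposes no condition.
Σ<-or : ℕ → (ℕ → ℕ) → ℕ → ℕ
Σ<-or zero    f z = z
Σ<-or (suc k) f z = Σ< (suc k) f

#cuts : ℕ → List ℕ → ℕ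
#cuts zero    ts       = 1
#cuts (suc n) []       = Σ< (suc n) (λ y → #cuts n (y ∷ []))
#cuts (suc n) (t ∷ ts) =
  Σ<-or (suc n ∸ t) (λ i → #cuts n (t + i ∷ t ∷ ts)) (#cuts (suc n) ts)

descending-bound : ∀ {y} ts → Descending y ts → All (_≤ y) ts
descending-bound []       _         = []
descending-bound (t ∷ ts) (t≤y , d) = t≤y ∷ All.map (λ s≤t → ≤-trans s≤t t≤y) (descending-bound ts d)

cuts-ins : ∀ {ts} (y : Fin (suc n)) (τ : Vec (Fin n) n) → All (_≤ toℕ y) ts →
           Cuts n (toℕ y ∷ ts) τ ⇔ Cuts (suc n) ts (ins y τ)
cuts-ins {n} {ts} y τ ts≤y = mk⇔
  (λ where
   (av , c ∷ cs) →
    from (avoids-a-bc-ins p213 y τ) (av , NoAdjacent-mono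
      (λ (l , r) → skip-< (toℕ y) ≤-refl l , skip-> (toℕ y) r) c) ,
    All.zipWith (λ (t≤y , c′) → from (NoAdjacent-ins y τ)
      (head-is (λ _ _ (y<t , _) → ≤⇒≯ t≤y y<t) , NoAdjacent-mono
        (λ (l , r) → skip-< (toℕ y) t≤y l , skip-≥ (toℕ y) t≤y r) c′)) (ts≤y , cs))
  (λ (av , cs) → let av′ , c = to (avoids-a-bc-ins p213 y τ) av in
    av′ , NoAdjacent-mono (λ (l , r) → <-skip (toℕ y) ≤-refl l , >-skip (toℕ y) r) c ∷
    All.zipWith (λ (t≤y , c′) → NoAdjacent-mono
      (λ (l , r) → <-skip (toℕ y) t≤y l , ≥-skip (toℕ y) t≤y r) (proj₂ (to (NoAdjacent-ins y τ) c′))) (ts≤y , cs))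

never-crosses : ∀ {t} (v : Vec (Fin (suc n)) (suc n)) → NoAdjacent (λ x x′ → x < t × t ≤ x′) v →
                val v zero < t → ∀ i → val v i < t
never-crosses {n} {t} v na below i = go (toℕ i) i refl
  where
  go : ∀ k i → toℕ i ≡ k → val v i < t
  go zero    zero    _  = below
  go (suc k) i       eq = ≰⇒> λ t≤ → excludes na j i (trans eq (cong suc (sym j≡k))) (go k j j≡k , t≤)
    where
    k<n : k < suc n
    k<n = <-trans (n<1+n k) (subst (_< suc n) eq (Fin.toℕ<n i))
    j = fromℕ< k<n
    j≡k = Fin.toℕ-fromℕ< k<n

#cuts-below : ∀ n {t} ts → t ≤ n → #cuts (suc n) (t ∷ ts) ≡ Σ< (suc (n ∸ t)) (λ i → #cuts n (t + i ∷ t ∷ ts))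
#cuts-below n {t} ts t≤n rewrite +-∸-assoc 1 t≤n = refl

#cuts-top : ∀ n ts → #cuts (suc n) (suc n ∷ ts) ≡ #cuts (suc n) ts
#cuts-top n ts rewrite n∸n≡0 n = refl

-- If t ≤ n, the maximum n still has to come and a sequence that starts below t can never climb to
-- it, so the first entry is at least t. If t = n + 1, no value lies above the cut and the cut is
-- dropped.
card-cuts-∷ : ∀ n t ts → Descending (suc n) (t ∷ ts) →
  (∀ y → Descending n (y ∷ t ∷ ts) → Card (Cuts n (y ∷ t ∷ ts)) (#cuts n (y ∷ t ∷ ts))) →
  (Descending (suc n) ts → Card (Cuts (suc n) ts) (#cuts (suc n) ts)) →
  Card (Cuts (suc n) (t ∷ ts)) (#cuts (suc n) (t ∷ ts))
card-cuts-∷ n t ts (t≤1+n , d) below top with m≤n⇒m<n∨m≡n t≤1+n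
... | inj₁ (s≤s t≤n) = subst (Card _) (sym (#cuts-below n ts t≤n)) (upto-full (≤-reflexive (sym t+))
  (upto-Σ (suc (n ∸ t)) (≤-reflexive t+) (upto-∅ z≤n upto-zero crossing) λ i _ y y≡ →
    let t≤y = ≤-trans (m≤m+n t i) (≤-reflexive (sym y≡)) in
    Card-cong (λ {τ} _ → cuts-ins y τ (descending-bound (t ∷ ts) (t≤y , d)))
      (subst (λ z → Card (Cuts n (toℕ y ∷ t ∷ ts)) (#cuts n (z ∷ t ∷ ts))) y≡
        (below (toℕ y) (s≤s⁻¹ (Fin.toℕ<n y) , t≤y , d)))))
  where
  t+ : t + suc (n ∸ t) ≡ suc n
  t+ = trans (+-suc t (n ∸ t)) (cong suc (m+[n∸m]≡n t≤n))
  crossing : ∀ {τ} → IsPermutation τ → ∀ y → 0 ≤ toℕ y → toℕ y < t → ¬ Cuts (suc n) (t ∷ ts) (ins y τ)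
  crossing {τ} perm y _ y<t (_ , c ∷ _) =
    let i , eq = attains (ins y τ) (ins-permutation y perm) (n<1+n n) in
    ≤⇒≯ t≤n (subst (_< t) eq (never-crosses (ins y τ) c y<t i))
... | inj₂ refl = subst (Card _) (sym (#cuts-top n ts)) (Card-cong (λ {τ} _ → mk⇔
    (λ (av , cs) → av , noAdjacent (λ _ k _ (_ , t≤) → ≤⇒≯ t≤ (Fin.toℕ<n (lookup τ k))) ∷ cs)
    (λ where (av , _ ∷ cs) → av , cs))
  (top d))

card-cuts : ∀ n ts → Descending n ts → Card (Cuts n ts) (#cuts n ts)
card-cuts zero    ts       _ = Card-[] (avoids-[] (a-bc p213) , All.universal (λ _ → noAdjacent λ ()) ts)
card-cuts (suc n) []       _ = card-by-head λ y →
  Card-cong (λ {τ} _ → cuts-ins y τ []) (card-cuts n (toℕ y ∷ []) (s≤s⁻¹ (Fin.toℕ<n y) , tt))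
card-cuts (suc n) (t ∷ ts) d =
  card-cuts-∷ n t ts d (λ y → card-cuts n (y ∷ t ∷ ts)) (card-cuts (suc n) ts)

catalan : ℕ → ℕ
catalan n = #cuts n []

-- A first entry t + i separates n ∸ t ∸ i values above it, i values between it and the cut t, and t
-- values below the cut. The last factor is common to all summands, and the other two sum to a
-- Catalan number. With ts = [] these summands are those of Segner's recurrence, which identifies
-- `catalan`.
#cuts-∷ : ∀ n t ts → t ≤ n → #cuts n (t ∷ ts) ≡ catalan (n ∸ t) * #cuts t ts
#cuts-∷ n = go (suc n) n (n<1+n n)
  where
  -- N bounds the recursion, since `split` needs the formula at n, at t + i and at n ∸ t.
  go : ∀ N n → n < N → ∀ t ts → t ≤ n → #cuts n (t ∷ ts) ≡ catalan (n ∸ t) * #cuts t ts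
  go (suc N) zero    _         zero ts z≤n = refl
  go (suc N) (suc n) (s≤s n<N) t    ts t≤1+n = [ below ∘ s≤s⁻¹ , (λ where refl → top) ]′ (m≤n⇒m<n∨m≡n t≤1+n)
    where
    open ≡-Reasoning
    top : #cuts (suc n) (suc n ∷ ts) ≡ catalan (n ∸ n) * #cuts (suc n) ts
    top = trans (#cuts-top n ts) (sym (trans (cong (λ k → catalan k * #cuts (suc n) ts) (n∸n≡0 n)) (+-identityʳ _)))
    split : t ≤ n → ∀ i → i < suc (n ∸ t) → #cuts n (t + i ∷ t ∷ ts) ≡ #cuts (n ∸ t) (i ∷ []) * #cuts t ts
    below : t ≤ n → #cuts (suc n) (t ∷ ts) ≡ catalan (suc n ∸ t) * #cuts t ts
    below t≤n = begin
      #cuts (suc n) (t ∷ ts)                                       ≡⟨ #cuts-below n ts t≤n ⟩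
      Σ< (suc (n ∸ t)) (λ i → #cuts n (t + i ∷ t ∷ ts))            ≡⟨ Σ<-cong (suc (n ∸ t)) (split t≤n) ⟩
      Σ< (suc (n ∸ t)) (λ i → #cuts (n ∸ t) (i ∷ []) * #cuts t ts) ≡⟨ Σ<-*ʳ (suc (n ∸ t)) _ _ ⟩
      catalan (suc (n ∸ t)) * #cuts t ts                           ≡⟨ cong (λ k → catalan k * #cuts t ts) (+-∸-assoc 1 t≤n) ⟨
      catalan (suc n ∸ t) * #cuts t ts                             ∎
    split t≤n i (s≤s i≤n∸t) = begin
      #cuts n (t + i ∷ t ∷ ts)                           ≡⟨ go N n n<N (t + i) (t ∷ ts) t+i≤n ⟩
      catalan (n ∸ (t + i)) * #cuts (t + i) (t ∷ ts)     ≡⟨ cong (catalan (n ∸ (t + i)) *_)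
                                                             (go N (t + i) (≤-<-trans t+i≤n n<N) t ts (m≤m+n t i)) ⟩
      catalan (n ∸ (t + i)) * (catalan (t + i ∸ t) * #cuts t ts)
        ≡⟨ cong₂ (λ a b → catalan a * (catalan b * #cuts t ts)) (sym (∸-+-assoc n t i)) (m+n∸m≡n t i) ⟩
      catalan (n ∸ t ∸ i) * (catalan i * #cuts t ts)     ≡⟨ *-assoc (catalan (n ∸ t ∸ i)) (catalan i) _ ⟨
      catalan (n ∸ t ∸ i) * catalan i * #cuts t ts       ≡⟨ cong (_* #cuts t ts)
                                                             (go N (n ∸ t) (≤-<-trans (m∸n≤m n t) n<N) i [] i≤n∸t) ⟨
      #cuts (n ∸ t) (i ∷ []) * #cuts t ts                ∎
      where
      t+i≤n : t + i ≤ n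
      t+i≤n = ≤-trans (+-monoʳ-≤ t i≤n∸t) (≤-reflexive (m+[n∸m]≡n t≤n))

card-2-13 : ∀ n y → Card (λ (τ : Vec (Fin n) n) → Avoids (ins y τ) (a-bc p213)) (catalan (n ∸ toℕ y) * catalan (toℕ y))
card-2-13 n y = subst (Card _) (#cuts-∷ n (toℕ y) [] y≤n)
  (Card-cong (λ {τ} _ → mk⇔ (proj₁ ∘ to (cuts-ins y τ [])) (λ av → from (cuts-ins y τ []) (av , [])))
    (card-cuts n (toℕ y ∷ []) (y≤n , tt)))
  where y≤n = s≤s⁻¹ (Fin.toℕ<n y)

card-avoiders-2-13 : ∀ n → Avoiders n (a-bc p213) (catalan n)
card-avoiders-2-13 n = Card-cong (λ _ → mk⇔ proj₁ (_, [])) (card-cuts n [] tt)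

-- Bell, Catalan and ballot numbers

-- A maximal first entry takes part in no 12-3, so the diagonal gives the total for length n. Apart
-- from a repeated last entry, the rows from row 1 on are those of the Bell triangle: each begins
-- with the last entry of the row before and grows by its entries.
bell : ℕ → ℕ
bell n = #12-3 n n

#12-3-row : ∀ n {y} → y ≤ n → #12-3 (suc n) y ≡ Σ< y (#12-3 n) + bell n
#12-3-row n y≤n = cong (λ k → Σ< k (#12-3 n) + bell n) (m≤n⇒m⊓n≡m y≤n)

bell-suc : ∀ n → bell (suc n) ≡ Σ< (suc n) (#12-3 n)
bell-suc n = cong (λ k → Σ< k (#12-3 n) + bell n) (m≥n⇒m⊓n≡n (n≤1+n n))

#13-2-row : ∀ n {y} → y ≤ n → #13-2 (suc n) y ≡ Σ< (suc y) (#13-2 n)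
#13-2-row n y≤n = cong (λ k → Σ< (suc k) (#13-2 n)) (m≤n⇒m⊓n≡m y≤n)

#13-2-last : ∀ n → #13-2 (suc n) (suc n) ≡ Σ< (suc n) (#13-2 n)
#13-2-last n = cong (λ k → Σ< (suc k) (#13-2 n)) (m≥n⇒m⊓n≡n (n≤1+n n))

card-avoiders-12-3 : ∀ n → Avoiders n (ab-c p123) (bell n)
card-avoiders-12-3 zero    = Card-[] (avoids-[] (ab-c p123))
card-avoiders-12-3 (suc n) = subst (Avoiders (suc n) (ab-c p123)) (sym (bell-suc n)) (card-by-head (card-12-3 n))

card-avoiders-13-2 : ∀ n → Avoiders n (ab-c p132) (#13-2 n n)
card-avoiders-13-2 zero    = Card-[] (avoids-[] (ab-c p132))
card-avoiders-13-2 (suc n) = subst (Avoiders (suc n) (ab-c p132)) (sym (#13-2-last n)) (card-by-head (card-13-2 n))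

card-avoiders-23-1 : ∀ n → Avoiders n (ab-c p231) (#23-1 n 0)
card-avoiders-23-1 zero    = Card-[] (avoids-[] (ab-c p231))
card-avoiders-23-1 (suc n) = card-by-head (card-23-1 n)

card-avoiders-1-23 : ∀ n → Avoiders n (a-bc p123) (#1-bc n n 0)
card-avoiders-1-23 zero    = Card-[] (avoids-[] (a-bc p123))
card-avoiders-1-23 (suc n) = subst (Avoiders (suc n) (a-bc p123)) (sym (+-identityʳ _)) (card-by-head (card-1-23 n))

card-avoiders-1-32 : ∀ n → Avoiders n (a-bc p132) (#1-bc n n 0)
card-avoiders-1-32 zero    = Card-[] (avoids-[] (a-bc p132))
card-avoiders-1-32 (suc n) = subst (Avoiders (suc n) (a-bc p132)) (sym (+-identityʳ _)) (card-by-head (card-1-32 n))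

-- Reversal takes 1-23 to 32-1, and complementation takes that to 12-3.
#1-bc≡bell : ∀ n → #1-bc n n 0 ≡ bell n
#1-bc≡bell n = card-unique
  (card-complement (ab-c p321) (card-reverse (a-bc p123) (card-avoiders-1-23 n))) (card-avoiders-12-3 n)

-- Reversal takes 1-32 to 23-1; the recurrence that 1-32 shares with 1-23 provides the link to
-- `bell`.
#23-1≡bell : ∀ n → #23-1 n 0 ≡ bell n
#23-1≡bell n = trans
  (card-unique (card-avoiders-23-1 n) (card-reverse (a-bc p132) (card-avoiders-1-32 n))) (#1-bc≡bell n)

#13-2≡catalan : ∀ n → #13-2 n n ≡ catalan n
#13-2≡catalan n = card-unique (card-avoiders-13-2 n)
  (card-complement (ab-c p312) (card-reverse (a-bc p213) (card-avoiders-2-13 n)))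

-- Growth of the Catalan and Bell numbers.

Σ<-mono : ∀ k {f g : ℕ → ℕ} → (∀ i → i < k → f i ≤ g i) → Σ< k f ≤ Σ< k g
Σ<-mono zero    _   = z≤n
Σ<-mono (suc k) f≤g = +-mono-≤ (Σ<-mono k (λ i i<k → f≤g i (m<n⇒m<1+n i<k))) (f≤g k ≤-refl)

Σ<-mono-bound : ∀ {k l} (f : ℕ → ℕ) → k ≤ l → Σ< k f ≤ Σ< l f
Σ<-mono-bound {k} {zero}  f z≤n = z≤n
Σ<-mono-bound {k} {suc l} f k≤l with k ≟ suc l
... | yes refl = ≤-refl
... | no  k≢l  = ≤-trans (Σ<-mono-bound f (s≤s⁻¹ (≤∧≢⇒< k≤l k≢l))) (m≤m+n _ (f l))

Σ<-zero : ∀ k {f : ℕ → ℕ} → (∀ i → i < k → f i ≡ 0) → Σ< k f ≡ 0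
Σ<-zero zero    _  = refl
Σ<-zero (suc k) f0 = cong₂ _+_ (Σ<-zero k (λ i i<k → f0 i (m<n⇒m<1+n i<k))) (f0 k ≤-refl)

#13-2-≤-last : ∀ n y → #13-2 n y ≤ #13-2 n n
#13-2-≤-last zero    y = ≤-refl
#13-2-≤-last (suc n) y = subst (#13-2 (suc n) y ≤_) (sym (#13-2-last n))
  (Σ<-mono-bound (#13-2 n) (s≤s (m⊓n≤n y n)))

-- Both rows add up the same initial segment; the one further term is entry y ⊓ n for 13-2, but the
-- last and largest entry in the case of 12-3.
#13-2≤#12-3 : ∀ n y → #13-2 n y ≤ #12-3 n y
#13-2≤#12-3 zero    y = ≤-refl
#13-2≤#12-3 (suc n) y = +-mono-≤ (Σ<-mono (y ⊓ n) (λ i _ → #13-2≤#12-3 n i))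
  (≤-trans (#13-2-≤-last n (y ⊓ n)) (#13-2≤#12-3 n n))

catalan<bell : ∀ n → 4 ≤ n → #13-2 n n < bell n
catalan<bell n 4≤n = subst (λ n → #13-2 n n < bell n) (m∸n+n≡m 4≤n) (go (n ∸ 4))
  where
  go : ∀ k → #13-2 (k + 4) (k + 4) < bell (k + 4)
  -- This is 14 < 15.
  go zero    = ≤-refl
  go (suc k) = subst₂ _<_ (sym (#13-2-last (k + 4))) (sym (bell-suc (k + 4)))
    (+-mono-≤-< (Σ<-mono (k + 4) (λ i _ → #13-2≤#12-3 (k + 4) i)) (go k))

#13-2-first : ∀ n → #13-2 n 0 ≡ 1
#13-2-first zero    = refl
#13-2-first (suc n) = #13-2-first n

#13-2-second : ∀ n → #13-2 (suc n) 1 ≡ suc n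
#13-2-second zero    = refl
#13-2-second (suc n) = cong₂ _+_ (#13-2-first (suc n)) (#13-2-second n)

#13-2-last< : ∀ n → 1 ≤ n → #13-2 n n < #13-2 (suc n) (suc n)
#13-2-last< (suc n) _ = subst (#13-2 (suc n) (suc n) <_) (sym (#13-2-last (suc n)))
  (m<n+m _ (<-≤-trans (subst (0 <_) (sym (#13-2-first (suc n))) z<s) (Σ<-mono-bound {1} {suc n} (#13-2 (suc n)) (s≤s z≤n))))

1<#13-2-last : ∀ n → 2 ≤ n → 1 < #13-2 n n
1<#13-2-last (suc zero)    (s≤s ())
1<#13-2-last (suc (suc n)) _ = <-≤-trans (s≤s (pos n)) (#13-2-last< (suc n) (s≤s z≤n))
  where
  pos : ∀ n → 1 ≤ #13-2 (suc n) (suc n)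
  pos n = subst (1 ≤_) (sym (#13-2-last n)) (≤-trans (≤-reflexive (sym (#13-2-first n)))
    (Σ<-mono-bound (#13-2 n) (s≤s z≤n)))

-- In these coordinates the recurrence is that of lattice paths staying at height at least 0, with r
-- down steps and k + r up steps: the last step reaches height k from k + 1 or k - 1.
ballot : ℕ → ℕ → ℕ
ballot r k = #13-2 (k + r) r

ballot-zero : ∀ r → ballot (suc r) 0 ≡ ballot r 1
ballot-zero r = trans (#13-2-last r) (sym (#13-2-row r ≤-refl))

ballot-suc : ∀ r k → ballot (suc r) (suc k) ≡ ballot r (2 + k) + ballot (suc r) k
ballot-suc r k = trans (#13-2-row (k + suc r) (m≤n+m (suc r) k))
  (cong (_+ ballot (suc r) k) (trans (sym (#13-2-row (k + suc r) (≤-trans (n≤1+n r) (m≤n+m (suc r) k))))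
    (cong (λ n → #13-2 (suc n) r) (+-suc k r))))

-- The number 2 * b / (k + 3) separates the two quotients: (x + b) / (k + 4) lies below it and (b +
-- z) / (k + 2) does not, because k + 5 and k + 1 each average with k + 3 to k + 4 and k + 2.
-- Multiplying by k + 3 clears the fraction.
ratio-step : ∀ k x b z → (3 + k) * x < (5 + k) * b → (1 + k) * b ≤ (3 + k) * z →
             (2 + k) * (x + b) < (4 + k) * (b + z)
ratio-step k x b z x<b b≤z = *-cancelˡ-< (3 + k) _ _ (begin-strict
  (3 + k) * ((2 + k) * (x + b))                     ≡⟨ e₁ k x b ⟩
  (2 + k) * ((3 + k) * x) + (2 + k) * ((3 + k) * b) <⟨ +-monoˡ-< ((2 + k) * ((3 + k) * b)) (*-monoʳ-< (2 + k) x<b) ⟩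
  (2 + k) * ((5 + k) * b) + (2 + k) * ((3 + k) * b) ≡⟨ e₂ k b ⟩
  (4 + k) * ((3 + k) * b) + (4 + k) * ((1 + k) * b) ≤⟨ +-monoʳ-≤ ((4 + k) * ((3 + k) * b)) (*-monoʳ-≤ (4 + k) b≤z) ⟩
  (4 + k) * ((3 + k) * b) + (4 + k) * ((3 + k) * z) ≡⟨ e₃ k b z ⟩
  (3 + k) * ((4 + k) * (b + z))                     ∎)
  where
  open ≤-Reasoning
  e₁ : ∀ k x b → (3 + k) * ((2 + k) * (x + b)) ≡ (2 + k) * ((3 + k) * x) + (2 + k) * ((3 + k) * b)
  e₁ = solve-∀
  e₂ : ∀ k b → (2 + k) * ((5 + k) * b) + (2 + k) * ((3 + k) * b) ≡ (4 + k) * ((3 + k) * b) + (4 + k) * ((1 + k) * b)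
  e₂ = solve-∀
  e₃ : ∀ k b z → (4 + k) * ((3 + k) * b) + (4 + k) * ((3 + k) * z) ≡ (3 + k) * ((4 + k) * (b + z))
  e₃ = solve-∀

-- The step at the wall: height 0 is reached only from height 1, so the third neighbour z is
-- missing.
ratio-base : ∀ x b → 2 * x < 4 * b → 1 * (x + b) < 3 * b
ratio-base x b x<b = *-cancelˡ-< 2 _ _ (begin-strict
  2 * (1 * (x + b)) ≡⟨ e₁ x b ⟩
  2 * x + 2 * b     <⟨ +-monoˡ-< (2 * b) x<b ⟩
  4 * b + 2 * b     ≡⟨ e₂ b ⟩
  2 * (3 * b)       ∎)
  where
  open ≤-Reasoning
  e₁ : ∀ x b → 2 * (1 * (x + b)) ≡ 2 * x + 2 * b
  e₁ = solve-∀
  e₂ : ∀ b → 4 * b + 2 * b ≡ 2 * (3 * b)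
  e₂ = solve-∀

-- Among the ballot numbers counting paths of one common length, ballot r k / (k + 1) decreases with k.
ballot-ratio : ∀ r k → suc k * ballot r (2 + k) < (3 + k) * ballot (suc r) k
ballot-ratio zero    zero    = s≤s (s≤s z≤n)
ballot-ratio (suc r) zero    = subst₂ (λ a b → 1 * a < 3 * b) (sym (ballot-suc r 1)) (sym (ballot-zero (suc r)))
  (ratio-base (ballot r 3) (ballot (suc r) 1) (ballot-ratio r 1))
ballot-ratio zero    (suc k) = begin-strict
  (2 + k) * ballot 0 (3 + k)           ≡⟨ cong ((2 + k) *_) (#13-2-first (3 + k + 0)) ⟩
  (2 + k) * 1                          <⟨ *-monoˡ-< 1 {2 + k} {4 + k} (s≤s (s≤s (s≤s (n≤1+n k)))) ⟩
  (4 + k) * 1                          ≡⟨ cong ((4 + k) *_) (#13-2-first (2 + k + 0)) ⟨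
  (4 + k) * ballot 0 (2 + k)           ≤⟨ *-monoʳ-≤ (4 + k) (m≤m+n (ballot 0 (2 + k)) (ballot 1 k)) ⟩
  (4 + k) * (ballot 0 (2 + k) + ballot 1 k) ≡⟨ cong ((4 + k) *_) (ballot-suc 0 k) ⟨
  (4 + k) * ballot 1 (suc k)           ∎
  where open ≤-Reasoning
ballot-ratio (suc r) (suc k) = subst₂ (λ a b → (2 + k) * a < (4 + k) * b)
  (sym (ballot-suc r (2 + k))) (sym (ballot-suc (suc r) k))
  (ratio-step k (ballot r (4 + k)) (ballot (suc r) (2 + k)) (ballot (2 + r) k) (ballot-ratio r (2 + k)) (<⇒≤ (ballot-ratio (suc r) k)))

-- Undoing the last two steps of a path that ends at height 0 leads to height 2 or 0. The ratio
-- bound at k = 0 makes the first kind less than three times the second, and 4 = 3 + 1.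
#13-2-last<4* : ∀ n → 1 ≤ n → #13-2 (suc n) (suc n) < 4 * #13-2 n n
#13-2-last<4* (suc n) _ = begin-strict
  ballot (2 + n) 0                      ≡⟨ ballot-zero (suc n) ⟩
  ballot (suc n) 1                      ≡⟨ ballot-suc n 0 ⟩
  ballot n 2 + ballot (suc n) 0         ≡⟨ cong (_+ ballot (suc n) 0) (*-identityˡ (ballot n 2)) ⟨
  1 * ballot n 2 + ballot (suc n) 0     <⟨ +-monoˡ-< (ballot (suc n) 0) (ballot-ratio n 0) ⟩
  3 * ballot (suc n) 0 + ballot (suc n) 0 ≡⟨ +-comm (3 * ballot (suc n) 0) _ ⟩
  4 * ballot (suc n) 0                  ∎
  where open ≤-Reasoning

bell-row : ∀ n → #12-3 (suc n) n ≡ bell (suc n)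
bell-row n = trans (#12-3-row n ≤-refl) (sym (bell-suc n))

bell-positive : ∀ n → 0 < bell n
bell-positive zero    = z<s
bell-positive (suc n) = subst (0 <_) (sym (bell-suc n)) (<-≤-trans (bell-positive n) (m≤n+m (bell n) _))

-- Row n sums to `bell (suc n)`. Its last two entries both equal `bell n`, and its entries 0 and n -
-- 2 together give `bell n` once more. These two are distinct from n = 3 on, where the row 2, 3, 5,
-- 5 gives equality.
3*bell≤bell : ∀ n → 3 ≤ n → 3 * bell n ≤ bell (suc n)
3*bell≤bell (suc (suc zero)) (s≤s (s≤s ()))
3*bell≤bell (suc zero) (s≤s ())
3*bell≤bell (suc (suc (suc q))) _ = begin
  3 * bell (3 + q)                                        ≡⟨ e (bell (3 + q)) ⟩
  bell (3 + q) + bell (3 + q) + bell (3 + q)              ≤⟨ +-monoˡ-≤ _ (+-monoˡ-≤ _ low) ⟩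
  Σ< (2 + q) (#12-3 (3 + q)) + bell (3 + q) + bell (3 + q) ≡⟨ cong (λ b → Σ< (2 + q) (#12-3 (3 + q)) + b + bell (3 + q)) (bell-row (2 + q)) ⟨
  Σ< (3 + q) (#12-3 (3 + q)) + bell (3 + q)               ≡⟨ bell-suc (3 + q) ⟨
  bell (4 + q)                                            ∎
  where
  open ≤-Reasoning
  e : ∀ b → 3 * b ≡ b + b + b
  e = solve-∀
  swap : ∀ a b c → a + b + c ≡ b + (a + c)
  swap = solve-∀
  low : bell (3 + q) ≤ Σ< (2 + q) (#12-3 (3 + q))
  low = begin
    bell (3 + q)                                                      ≡⟨ bell-suc (2 + q) ⟩
    Σ< (1 + q) (#12-3 (2 + q)) + #12-3 (2 + q) (1 + q) + bell (2 + q) ≡⟨ swap (Σ< (1 + q) (#12-3 (2 + q))) _ _ ⟩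
    #12-3 (2 + q) (1 + q) + (Σ< (1 + q) (#12-3 (2 + q)) + bell (2 + q)) ≡⟨ cong₂ _+_ (bell-row (1 + q))
                                                                       (sym (#12-3-row (2 + q) (n≤1+n (1 + q)))) ⟩
    bell (2 + q) + #12-3 (3 + q) (1 + q)                              ≤⟨ +-monoˡ-≤ _ (Σ<-mono-bound {1} {1 + q} (#12-3 (3 + q)) (s≤s z≤n)) ⟩
    Σ< (2 + q) (#12-3 (3 + q))                                        ∎

2*bell<bell : ∀ n → 3 ≤ n → bell n + bell n < bell (suc n)
2*bell<bell n 3≤n = <-≤-trans (subst (bell n + bell n <_) (e (bell n)) (m<m+n (bell n + bell n) (bell-positive n))) (3*bell≤bell n 3≤n)
  where
  e : ∀ b → b + b + b ≡ 3 * b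
  e = solve-∀

bell<bell : ∀ n → 3 ≤ n → bell n < bell (suc n)
bell<bell n 3≤n = ≤-<-trans (m≤m+n (bell n) (bell n)) (2*bell<bell n 3≤n)

1<bell : ∀ n → 2 ≤ n → 1 < bell n
1<bell (suc zero) (s≤s ())
1<bell (suc (suc n)) _ = subst (1 <_) (sym (bell-suc (suc n))) (+-mono-≤
  (≤-trans (bell-positive n) (Σ<-mono-bound {1} {suc n} (#12-3 (suc n)) (s≤s z≤n)))
  (bell-positive (suc n)))
-- With m = 0 no new minimum is possible, so all n remaining entries would have to continue the run,
-- for which j values are too few.
#1-bc-incomplete : ∀ n j → j < n → #1-bc n 0 j ≡ 0
#1-bc-incomplete (suc n) j (s≤s j≤n) = Σ<-zero j λ i i<j → #1-bc-incomplete n i (<-≤-trans i<j j≤n)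

#1-bc-decreasing : ∀ n → #1-bc n 0 n ≡ 1
#1-bc-decreasing zero    = refl
#1-bc-decreasing (suc n) = cong₂ _+_ (Σ<-zero n (#1-bc-incomplete n)) (#1-bc-decreasing n)

Σ<-2^ : ∀ j → 1 + Σ< j (2 ^_) ≡ 2 ^ j
Σ<-2^ zero    = refl
Σ<-2^ (suc j) = trans (cong (_+ 2 ^ j) (Σ<-2^ j)) (cong (2 ^ j +_) (sym (+-identityʳ (2 ^ j))))

-- Before the last minimum arrives the run may use any subset of its j candidates; what follows that
-- minimum is a single forced run.
#1-bc-one-below : ∀ n j → j ≤ n → #1-bc (suc n) 1 j ≡ 2 ^ j
#1-bc-one-below zero    zero z≤n = refl
#1-bc-one-below (suc n) j j≤n = trans (cong₂ _+_ (#1-bc-decreasing (suc n))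
  (Σ<-cong j λ i i<j → #1-bc-one-below n i (s≤s⁻¹ (<-≤-trans i<j j≤n)))) (Σ<-2^ j)

1+n<2^n : ∀ n → 2 ≤ n → suc n < 2 ^ n
1+n<2^n (suc zero)              (s≤s ())
1+n<2^n (suc (suc zero))        _ = ≤-refl
1+n<2^n (suc n@(suc (suc _))) _ = double (1+n<2^n n (s≤s (s≤s z≤n)))
  where
  open ≤-Reasoning
  double : suc n < 2 ^ n → suc (suc n) < 2 ^ suc n
  double n<2^n = begin-strict
    suc (suc n)         <⟨ m<n+m (suc (suc n)) {suc n} z<s ⟩
    suc n + suc (suc n) ≤⟨ +-mono-≤ (<⇒≤ n<2^n) n<2^n ⟩
    2 ^ n + 2 ^ n       ≡⟨ cong (2 ^ n +_) (+-identityʳ (2 ^ n)) ⟨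
    2 ^ suc n           ∎

-- The nine classes

-- The list in the theorem unfolds to the tabulation of this function, and `class-of` inverts
-- membership. Covering, disjointness and the class property thus become statements about indices.
class : Fin 9 → List VincularPattern
class 0F = a-bc p213 ∷ a-bc p231 ∷ []
class 1F = a-bc p123 ∷ a-bc p132 ∷ []
class 2F = a-bc p321 ∷ a-bc p312 ∷ []
class 3F = [ ab-c p132 ]
class 4F = [ ab-c p312 ]
class 5F = [ ab-c p123 ]
class 6F = [ ab-c p213 ]
class 7F = [ ab-c p231 ]
class 8F = [ ab-c p321 ]

class-of : VincularPattern → Fin 9
class-of (a-bc p213) = 0F
class-of (a-bc p231) = 0F
class-of (a-bc p123) = 1F
class-of (a-bc p132) = 1F
class-of (a-bc p321) = 2F
class-of (a-bc p312) = 2F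
class-of (ab-c p132) = 3F
class-of (ab-c p312) = 4F
class-of (ab-c p123) = 5F
class-of (ab-c p213) = 6F
class-of (ab-c p231) = 7F
class-of (ab-c p321) = 8F

class-of-members : ∀ i → All (λ σ → class-of σ ≡ i) (class i)
class-of-members 0F = refl ∷ refl ∷ []
class-of-members 1F = refl ∷ refl ∷ []
class-of-members 2F = refl ∷ refl ∷ []
class-of-members 3F = refl ∷ []
class-of-members 4F = refl ∷ []
class-of-members 5F = refl ∷ []
class-of-members 6F = refl ∷ []
class-of-members 7F = refl ∷ []
class-of-members 8F = refl ∷ []

∈class-of : ∀ σ → σ ∈ class (class-of σ)
∈class-of (a-bc p213) = here refl
∈class-of (a-bc p231) = there (here refl)
∈class-of (a-bc p123) = here refl
∈class-of (a-bc p132) = there (here refl)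
∈class-of (a-bc p321) = here refl
∈class-of (a-bc p312) = there (here refl)
∈class-of (ab-c p132) = here refl
∈class-of (ab-c p312) = here refl
∈class-of (ab-c p123) = here refl
∈class-of (ab-c p213) = here refl
∈class-of (ab-c p231) = here refl
∈class-of (ab-c p321) = here refl

class-nonempty : ∀ i → ∃[ σ ] class-of σ ≡ i
class-nonempty 0F = a-bc p213 , refl
class-nonempty 1F = a-bc p123 , refl
class-nonempty 2F = a-bc p321 , refl
class-nonempty 3F = ab-c p132 , refl
class-nonempty 4F = ab-c p312 , refl
class-nonempty 5F = ab-c p123 , refl
class-nonempty 6F = ab-c p213 , refl
class-nonempty 7F = ab-c p231 , refl
class-nonempty 8F = ab-c p321 , refl

-- The size of S_{n+1,r+1} for the patterns of a class; complementation turns r into n ∸ r.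
count : Fin 9 → ℕ → ℕ → ℕ
count 0F n r = catalan (n ∸ r) * catalan r
count 1F n r = #1-bc n r (n ∸ r)
count 2F n r = count 1F n (n ∸ r)
count 3F n r = #13-2 n r
count 4F n r = #13-2 n (n ∸ r)
count 5F n r = #12-3 n r
count 6F n r = #23-1 n (n ∸ r)
count 7F n r = #23-1 n r
count 8F n r = #12-3 n (n ∸ r)

card-S-direct : ∀ {n r} σ (f : ℕ → ℕ) →
  (∀ y → Card (λ (τ : Vec (Fin n) n) → Avoids (ins y τ) σ) (f (toℕ y))) →
  r ≤ n → HasCardinality (S (suc n) (suc r) σ) (f r)
card-S-direct σ f card r≤n =
  card-S y y≡r (subst (λ k → Card (λ τ → Avoids (ins y τ) σ) (f k)) y≡r (card y))
  where
  y   = fromℕ< (s≤s r≤n)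
  y≡r = Fin.toℕ-fromℕ< (s≤s r≤n)

card-S-mirrored : ∀ {n r} σ (f : ℕ → ℕ) →
  (∀ y → Card (λ (τ : Vec (Fin n) n) → Avoids (ins y τ) σ) (f (toℕ y))) →
  r ≤ n → HasCardinality (S (suc n) (suc r) (complementᵖ σ)) (f (n ∸ r))
card-S-mirrored {n} {r} σ f card r≤n =
  subst (λ k → HasCardinality (S (suc n) (suc k) (complementᵖ σ)) (f (n ∸ r))) (m∸[m∸n]≡n r≤n)
    (card-S-complement σ (m∸n≤m n r) (card-S-direct σ f card (m∸n≤m n r)))

card-count : ∀ σ n r → r ≤ n → HasCardinality (S (suc n) (suc r) σ) (count (class-of σ) n r)
card-count (a-bc p213) n r = card-S-direct (a-bc p213) (λ k → catalan (n ∸ k) * catalan k) (card-2-13 n)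
card-count (a-bc p231) n r r≤n = subst (HasCardinality (S (suc n) (suc r) (a-bc p231)))
  (trans (cong (λ k → catalan k * catalan (n ∸ r)) (m∸[m∸n]≡n r≤n)) (*-comm (catalan r) (catalan (n ∸ r))))
  (card-S-mirrored (a-bc p213) (λ k → catalan (n ∸ k) * catalan k) (card-2-13 n) r≤n)
card-count (a-bc p123) n r = card-S-direct (a-bc p123) (λ k → #1-bc n k (n ∸ k)) (card-1-23 n)
card-count (a-bc p132) n r = card-S-direct (a-bc p132) (λ k → #1-bc n k (n ∸ k)) (card-1-32 n)
card-count (a-bc p321) n r = card-S-mirrored (a-bc p123) (λ k → #1-bc n k (n ∸ k)) (card-1-23 n)
card-count (a-bc p312) n r = card-S-mirrored (a-bc p132) (λ k → #1-bc n k (n ∸ k)) (card-1-32 n)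
card-count (ab-c p132) n r = card-S-direct (ab-c p132) (#13-2 n) (card-13-2 n)
card-count (ab-c p312) n r = card-S-mirrored (ab-c p132) (#13-2 n) (card-13-2 n)
card-count (ab-c p123) n r = card-S-direct (ab-c p123) (#12-3 n) (card-12-3 n)
card-count (ab-c p213) n r = card-S-mirrored (ab-c p231) (#23-1 n) (card-23-1 n)
card-count (ab-c p231) n r = card-S-direct (ab-c p231) (#23-1 n) (card-23-1 n)
card-count (ab-c p321) n r = card-S-mirrored (ab-c p123) (#12-3 n) (card-12-3 n)

Agree : ℕ → Fin 9 → Fin 9 → Set
Agree r i j = ∀ n → r ≤ n → count i n r ≡ count j n r

-- All indices are shifted: the first entry is r + 1 = q + 2, and `count i n r` belongs to length n
-- + 1. So `at-r` and `at-1+r` are the sizes for the two shortest admissible lengths.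
module Separation (q : ℕ) (3≤q : 3 ≤ q) where

  r = suc q

  3≤r : 3 ≤ r
  3≤r = m≤n⇒m≤1+n 3≤q

  C C′ B⁻ B B′ : ℕ
  C  = #13-2 r r
  C′ = #13-2 (suc r) (suc r)
  B⁻ = bell q
  B  = bell r
  B′ = bell (suc r)

  n∸n+1 : suc r ∸ r ≡ 1
  n∸n+1 = m+n∸n≡m 1 r

  at-r : Fin 9 → ℕ
  at-r 0F = C
  at-r 1F = B
  at-r 2F = 1
  at-r 3F = C
  at-r 4F = 1
  at-r 5F = B
  at-r 6F = B
  at-r 7F = B
  at-r 8F = B⁻

  count-at-r : ∀ i → count i r r ≡ at-r i
  count-at-r 0F = trans (cong (λ k → catalan k * catalan r) (n∸n≡0 r)) (trans (+-identityʳ _) (sym (#13-2≡catalan r)))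
  count-at-r 1F = trans (cong (#1-bc r r) (n∸n≡0 r)) (#1-bc≡bell r)
  count-at-r 2F = trans (cong (λ k → #1-bc r k (r ∸ k)) (n∸n≡0 r)) (#1-bc-decreasing r)
  count-at-r 3F = refl
  count-at-r 4F = trans (cong (#13-2 r) (n∸n≡0 r)) (#13-2-first r)
  count-at-r 5F = refl
  count-at-r 6F = trans (cong (#23-1 r) (n∸n≡0 r)) (#23-1≡bell r)
  count-at-r 7F = #23-1≡bell r
  count-at-r 8F = cong (#12-3 r) (n∸n≡0 r)

  at-1+r : Fin 9 → ℕ
  at-1+r 0F = C
  at-1+r 1F = B′
  at-1+r 2F = 2 ^ r
  at-1+r 3F = C′
  at-1+r 4F = suc r
  at-1+r 5F = B′
  at-1+r 6F = B
  at-1+r 7F = Σ< r (#23-1 r)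
  at-1+r 8F = B⁻ + B

  count-at-1+r : ∀ i → count i (suc r) r ≡ at-1+r i
  count-at-1+r 0F = trans (cong (λ k → catalan k * catalan r) n∸n+1) (trans (+-identityʳ _) (sym (#13-2≡catalan r)))
  count-at-1+r 1F = trans (cong (#1-bc (suc r) r) n∸n+1) (trans (sym e) (#1-bc≡bell (suc r)))
    where
    -- The summand y = r of the total, a new minimum, equals the single term that continues the run.
    e : #1-bc (suc r) (suc r) 0 ≡ #1-bc (suc r) r 1
    e = trans (+-identityʳ _) (cong (λ k → Σ< r (λ y → #1-bc r y (r ∸ y)) + #1-bc r r k) (n∸n≡0 r))
  count-at-1+r 2F = trans (cong (λ k → #1-bc (suc r) k (suc r ∸ k)) n∸n+1) (#1-bc-one-below r r ≤-refl)
  count-at-1+r 3F = trans (#13-2-row r ≤-refl) (sym (#13-2-last r))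
  count-at-1+r 4F = trans (cong (#13-2 (suc r)) n∸n+1) (#13-2-second r)
  count-at-1+r 5F = bell-row r
  count-at-1+r 6F = trans (cong (#23-1 (suc r)) n∸n+1) (#23-1≡bell r)
  count-at-1+r 7F = refl
  count-at-1+r 8F = cong (#12-3 (suc r)) n∸n+1

  1<C : 1 < C
  1<C = 1<#13-2-last r (≤-trans (n≤1+n 2) 3≤r)

  C<B : C < B
  C<B = catalan<bell r (s≤s 3≤q)

  C<C′ : C < C′
  C<C′ = #13-2-last< r (s≤s z≤n)

  1<B⁻ : 1 < B⁻
  1<B⁻ = 1<bell q (≤-trans (n≤1+n 2) 3≤q)

  B⁻<B : B⁻ < B
  B⁻<B = bell<bell q 3≤q

  1<B : 1 < B
  1<B = <-trans 1<B⁻ B⁻<B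

  B<B′ : B < B′
  B<B′ = bell<bell r 3≤r

  C<B⁻+B : C < B⁻ + B
  C<B⁻+B = <-≤-trans C<B (m≤n+m B B⁻)

  -- Since r is `suc q`, the last entry `#23-1 r r` is by definition the total `#23-1 r 0`. The
  -- count for 23-1 is therefore B′ - B, which exceeds B because Bell numbers more than double here.
  at-7+B : Σ< r (#23-1 r) + B ≡ B′
  at-7+B = trans (cong (Σ< r (#23-1 r) +_) (sym (#23-1≡bell r))) (#23-1≡bell (suc r))

  at-7<B′ : Σ< r (#23-1 r) < B′
  at-7<B′ = subst (Σ< r (#23-1 r) <_) at-7+B (m<m+n _ (bell-positive r))

  B<at-7 : B < Σ< r (#23-1 r)
  B<at-7 = +-cancelʳ-< B B (Σ< r (#23-1 r)) (subst (B + B <_) (sym at-7+B) (2*bell<bell r 3≤r))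

  -- The Catalan numbers C, C′ grow by a factor below 4, whereas B⁻ + B ≥ 4 B⁻.
  ¬13-2∼32-1 : C ≡ B⁻ → C′ ≢ B⁻ + B
  ¬13-2∼32-1 C≡B⁻ C′≡ = n≮n C′ (begin-strict
    C′             <⟨ #13-2-last<4* r (s≤s z≤n) ⟩
    4 * C          ≡⟨ cong (4 *_) C≡B⁻ ⟩
    B⁻ + 3 * B⁻    ≤⟨ +-monoʳ-≤ B⁻ (3*bell≤bell q 3≤q) ⟩
    B⁻ + B         ≡⟨ C′≡ ⟨
    C′             ∎)
    where open ≤-Reasoning

  -- The left count is bell (2 + r) ∸ bell (1 + r), which the right one exceeds.
  count-at-2+r : count 5F (2 + r) r < count 1F (2 + r) r
  count-at-2+r = +-cancelʳ-< B′ _ _ (begin-strict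
    #12-3 (2 + r) r + B′                           ≡⟨ row ⟩
    bell (2 + r)                                   <⟨ m<m+n (bell (2 + r)) positive ⟩
    bell (2 + r) + #1-bc (suc r) r 0               ≡⟨ run ⟩
    #1-bc (2 + r) r 2 + B′                         ≡⟨ cong (λ k → #1-bc (2 + r) r k + B′) (m+n∸n≡m 2 r) ⟨
    #1-bc (2 + r) r (2 + r ∸ r) + B′               ∎)
    where
    open ≤-Reasoning
    s = Σ< r (λ y → #1-bc (suc r) y (suc r ∸ y))
    z = #1-bc (suc r) r 0
    row : #12-3 (2 + r) r + B′ ≡ bell (2 + r)
    row = sym (trans (bell-suc (suc r)) (cong (_+ B′)
      (trans (cong (Σ< r (#12-3 (suc r)) +_) (bell-row r)) (sym (#12-3-row (suc r) (n≤1+n r))))))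
    -- Two values lie above the first entry. Continuing with one keeps the other available to the
    -- run, which gives `#1-bc (suc r) r 1`; continuing with the other does not, which gives z. Only
    -- the former occurs in the total.
    run : bell (2 + r) + z ≡ #1-bc (2 + r) r 2 + B′
    run = begin-equality
      bell (2 + r) + z                                             ≡⟨ cong (_+ z) (#1-bc≡bell (2 + r)) ⟨
      s + #1-bc (suc r) r (suc r ∸ r) + #1-bc (suc r) (suc r) (r ∸ r) + 0 + z
        ≡⟨ cong₂ (λ a b → s + #1-bc (suc r) r a + b + 0 + z) n∸n+1
             (trans (cong (#1-bc (suc r) (suc r)) (n∸n≡0 r)) (#1-bc≡bell (suc r))) ⟩
      s + #1-bc (suc r) r 1 + B′ + 0 + z                           ≡⟨ rearrange s (#1-bc (suc r) r 1) B′ z ⟩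
      s + (z + #1-bc (suc r) r 1) + B′                             ∎
      where
      rearrange : ∀ s o b z → s + o + b + 0 + z ≡ s + (z + o) + b
      rearrange = solve-∀
    -- The summand y = 0 counts the single monotone run that follows the least value.
    positive : 0 < #1-bc (suc r) r 0
    positive = <-≤-trans (subst (0 <_) (sym (#1-bc-decreasing r)) z<s)
      (≤-trans (Σ<-mono-bound {1} {r} (λ y → #1-bc r y (r ∸ y)) (s≤s z≤n)) (m≤m+n _ 0))

  differ : ∀ {i j} → at-r i < at-r j → ¬ Agree r i j
  differ {i} {j} lt agree = <⇒≢ lt (trans (sym (count-at-r i)) (trans (agree r ≤-refl) (count-at-r j)))

  differ> : ∀ {i j} → at-r j < at-r i → ¬ Agree r i j
  differ> {i} {j} lt agree = <⇒≢ lt (trans (sym (count-at-r j)) (trans (sym (agree r ≤-refl)) (count-at-r i)))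

  differ′ : ∀ {i j} → at-1+r i < at-1+r j → ¬ Agree r i j
  differ′ {i} {j} lt agree = <⇒≢ lt (trans (sym (count-at-1+r i)) (trans (agree (suc r) (n≤1+n r)) (count-at-1+r j)))

  differ′> : ∀ {i j} → at-1+r j < at-1+r i → ¬ Agree r i j
  differ′> {i} {j} lt agree = <⇒≢ lt (trans (sym (count-at-1+r j)) (trans (sym (agree (suc r) (n≤1+n r))) (count-at-1+r i)))

  separate : ∀ i j → i Fin.< j → ¬ Agree r i j
  separate 0F 1F _ = differ {0F} {1F} C<B
  separate 0F 2F _ = differ> {0F} {2F} 1<C
  separate 0F 3F _ = differ′ {0F} {3F} C<C′
  separate 0F 4F _ = differ> {0F} {4F} 1<C
  separate 0F 5F _ = differ {0F} {5F} C<B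
  separate 0F 6F _ = differ {0F} {6F} C<B
  separate 0F 7F _ = differ {0F} {7F} C<B
  separate 0F 8F _ = differ′ {0F} {8F} C<B⁻+B
  separate 1F 2F _ = differ> {1F} {2F} 1<B
  separate 1F 3F _ = differ> {1F} {3F} C<B
  separate 1F 4F _ = differ> {1F} {4F} 1<B
  separate 1F 5F _ agree = <⇒≢ count-at-2+r (sym (agree (2 + r) (m≤n+m r 2)))
  separate 1F 6F _ = differ′> {1F} {6F} B<B′
  separate 1F 7F _ = differ′> {1F} {7F} at-7<B′
  separate 1F 8F _ = differ> {1F} {8F} B⁻<B
  separate 2F 3F _ = differ {2F} {3F} 1<C
  separate 2F 4F _ = differ′> {2F} {4F} (1+n<2^n r (≤-trans (n≤1+n 2) 3≤r))
  separate 2F 5F _ = differ {2F} {5F} 1<B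
  separate 2F 6F _ = differ {2F} {6F} 1<B
  separate 2F 7F _ = differ {2F} {7F} 1<B
  separate 2F 8F _ = differ {2F} {8F} 1<B⁻
  separate 3F 4F _ = differ> {3F} {4F} 1<C
  separate 3F 5F _ = differ {3F} {5F} C<B
  separate 3F 6F _ = differ {3F} {6F} C<B
  separate 3F 7F _ = differ {3F} {7F} C<B
  separate 3F 8F _ agree = ¬13-2∼32-1
    (trans (agree r ≤-refl) (count-at-r 8F))
    (trans (sym (count-at-1+r 3F)) (trans (agree (suc r) (n≤1+n r)) (count-at-1+r 8F)))
  separate 4F 5F _ = differ {4F} {5F} 1<B
  separate 4F 6F _ = differ {4F} {6F} 1<B
  separate 4F 7F _ = differ {4F} {7F} 1<B
  separate 4F 8F _ = differ {4F} {8F} 1<B⁻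
  separate 5F 6F _ = differ′> {5F} {6F} B<B′
  separate 5F 7F _ = differ′> {5F} {7F} at-7<B′
  separate 5F 8F _ = differ> {5F} {8F} B⁻<B
  separate 6F 7F _ = differ′ {6F} {7F} B<at-7
  separate 6F 8F _ = differ> {6F} {8F} B⁻<B
  separate 7F 8F _ = differ> {7F} {8F} B⁻<B
  separate _ 0F ()
  separate (suc _) 1F (s≤s ())
  separate (suc (suc _)) 2F (s≤s (s≤s ()))
  separate (suc (suc (suc _))) 3F (s≤s (s≤s (s≤s ())))
  separate (suc (suc (suc (suc _)))) 4F (s≤s (s≤s (s≤s (s≤s ()))))
  separate (suc (suc (suc (suc (suc _))))) 5F (s≤s (s≤s (s≤s (s≤s (s≤s ())))))
  separate (suc (suc (suc (suc (suc (suc _)))))) 6F (s≤s (s≤s (s≤s (s≤s (s≤s (s≤s ()))))))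
  separate (suc (suc (suc (suc (suc (suc (suc _))))))) 7F (s≤s (s≤s (s≤s (s≤s (s≤s (s≤s (s≤s ())))))))
  separate 8F 8F (s≤s (s≤s (s≤s (s≤s (s≤s (s≤s (s≤s (s≤s ()))))))))

  agree⇒≡ : ∀ {i j} → Agree r i j → i ≡ j
  agree⇒≡ {i} {j} agree with Fin.<-cmp i j
  ... | tri< i<j _ _ = contradiction agree (separate i j i<j)
  ... | tri≈ _ i≡j _ = i≡j
  ... | tri> _ _ j<i = contradiction (λ n r≤n → sym (agree n r≤n)) (separate j i j<i)

-- From counts to equivalence classes.

equivalent : ∀ r {σ σ′} → class-of σ ≡ class-of σ′ → RWilfEquivalent (suc r) σ σ′
equivalent r {σ} {σ′} eq (suc n) (s≤s r≤n) = count (class-of σ) n r , card-count σ n r r≤n ,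
  subst (λ i → HasCardinality (S (suc n) (suc r) σ′) (count i n r)) (sym eq) (card-count σ′ n r r≤n)

equivalent⇒agree : ∀ r {σ σ′} → RWilfEquivalent (suc r) σ σ′ → Agree r (class-of σ) (class-of σ′)
equivalent⇒agree r {σ} {σ′} eqv n r≤n =
  let k , card , card′ = eqv (suc n) (s≤s r≤n) in
  trans (card-unique (card-count σ n r r≤n) card) (card-unique card′ (card-count σ′ n r r≤n))

theorem7p12 : ∀ (r : ℕ) → 5 ≤ r →
    let nine : List (List VincularPattern)
        nine = (a-bc p213 ∷ a-bc p231 ∷ [])
             ∷ (a-bc p123 ∷ a-bc p132 ∷ [])
             ∷ (a-bc p321 ∷ a-bc p312 ∷ [])
             ∷ [ ab-c p132 ]
             ∷ [ ab-c p312 ]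
             ∷ [ ab-c p123 ]
             ∷ [ ab-c p213 ]
             ∷ [ ab-c p231 ]
             ∷ [ ab-c p321 ]
             ∷ []
    in length nine ≡ 9 × AreTheClassesOf (RWilfEquivalent r) nine
theorem7p12 (suc (suc q)) (s≤s (s≤s 3≤q)) = refl , record
  { classes  = All.tabulate⁺ is-class
  ; covering = λ σ → Any.tabulate⁺ {f = class} (class-of σ) (∈class-of σ)
  ; distinct = AllPairs.tabulate⁺ {f = class} λ i≢j (σ∈i , σ∈j) →
      i≢j (trans (sym (All.lookup (class-of-members _) σ∈i)) (All.lookup (class-of-members _) σ∈j))
  }
  where
  open Separation q 3≤q using (agree⇒≡)
  is-class : ∀ i → IsClassOf (RWilfEquivalent (suc (suc q))) (class i)
  is-class i = let ρ , ρ∈ = class-nonempty i in ρ , λ σ → mk⇔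
    (λ σ∈ → equivalent (suc q) (trans ρ∈ (sym (All.lookup (class-of-members i) σ∈))))
    (λ ρ∼σ → subst (λ k → σ ∈ class k)
      (trans (sym (agree⇒≡ (equivalent⇒agree (suc q) ρ∼σ))) ρ∈) (∈class-of σ))
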